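{- Let $q$ be a prime power, $n\geq 5$ and $a\in\mathbb{F}_{q^n}$. Then the function $F:\mathbb{F}_{q^n}\to\mathbb{F}_{q^n}$, $F(x)=\mathrm{Tr}(x)^2+ax^2$, is not planar on $\mathbb{F}_{q^n}$.
   Context: $\mathrm{Tr}=\mathrm{Tr}_{\mathbb{F}_{q^n}/\mathbb{F}_q}$. A function $F:\mathbb{F}_{q^n}\to\mathbb{F}_{q^n}$ is called planar (perfect nonlinear) if for every $y\in\mathbb{F}_{q^n}^*$ the map $x\mapsto F(x+y)-F(x)-F(y)$ is a permutation of $\mathbb{F}_{q^n}$. -}

module Defs where

open import Level using (0ℓ)
open import Data.Nat using (ℕ; zero; suc; _^_; _≤_)
open import Data.Nat.Primality using (Prime)
open import Data.Fin using (Fin)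
open import Data.Product using (Σ; _×_; _,_)
open import Relation.Nullary using (¬_)
open import Relation.Binary.PropositionalEquality using (_≡_)
open import Algebra.Structures using (IsCommutativeRing)
open import Function.Bundles using (_↔_)
open import Function.Definitions using (Bijective)

PrimePower : ℕ → Set
PrimePower q = Σ ℕ λ p → Σ ℕ λ k → Prime p × (1 ≤ k) × (q ≡ p ^ k)

record FiniteField (N : ℕ) : Set₁ where
  infixl 6 _+_ _-_
  infix  8 -_
  infixr 9 _^ᶠ_
  infixl 7 _*_
  field
    Carrier : Set
    _+_ _*_ : Carrier → Carrier → Carrier
    -_      : Carrier → Carrier
    0# 1#   : Carrier
    isCommutativeRing : IsCommutativeRing _≡_ _+_ _*_ -_ 0# 1#
    0≢1     : ¬ (0# ≡ 1#)
    inverse : (x : Carrier) → ¬ (x ≡ 0#) → Σ Carrier λ y → x * y ≡ 1#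
    card    : Carrier ↔ Fin N

  _-_ : Carrier → Carrier → Carrier
  x - y = x + (- y)

  _^ᶠ_ : Carrier → ℕ → Carrier
  x ^ᶠ zero  = 1#
  x ^ᶠ suc m = x * (x ^ᶠ m)

  sumUpTo : ℕ → (ℕ → Carrier) → Carrier
  sumUpTo zero    f = 0#
  sumUpTo (suc m) f = sumUpTo m f + f m

Tr : (q n : ℕ) (K : FiniteField (q ^ n)) → FiniteField.Carrier K → FiniteField.Carrier K
Tr q n K x = sumUpTo n (λ i → x ^ᶠ (q ^ i))
  where open FiniteField K

Planar : {N : ℕ} (K : FiniteField N) → (FiniteField.Carrier K → FiniteField.Carrier K) → Set
Planar K F = (y : Carrier) → ¬ (y ≡ 0#) →
             Bijective _≡_ _≡_ (λ x → F (x + y) - F x - F y)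
  where open FiniteField K

{-# OPTIONS --safe #-}
module Submission where

-- Write q = 2h + 1; the cases p = 2 and a = 0 are easy. With b = -1/a, planarity forces
-- G(x) = Tr(x) Tr(b/x) ≠ 1 for all x ≠ 0. As G(x) lies in 𝔽_q, this gives G + G² + ... + G^(q-1) = 0 on K*.
-- Multiply by x^(h(q² + q³) - h(1 + q)), sum over K*, and expand the j-th powers of the traces into words w, w′ of
-- length j in the letters 0, ..., n-1, the letter i standing for the conjugate x^(q^i). A power sum over K* vanishes
-- unless its exponent is divisible by q^n - 1. As n ≥ 5, comparing base-q digits shows that this happens only when
-- w consists of h letters 0 and h letters 1, and w′ of h letters 2 and h letters 3.
-- So the total is -C(2h, h)² b^(h(q² + q³)), which is nonzero because C(q-1, h) ≡ ±1 modulo p.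

open import Defs
open import Data.Nat using (ℕ; _^_; _≤_)
open import Relation.Nullary using (¬_)

open import Level using (0ℓ)
open import Algebra.Bundles using (CommutativeMonoid; CommutativeRing)
open import Data.Bool using (if_then_else_)
open import Data.Empty using (⊥; ⊥-elim)
open import Data.Fin as Fin using (Fin; zero; suc; toℕ; fromℕ; inject≤; punchIn)
import Data.Fin.Properties as Fin
open import Data.Fin.Permutation using (permutation)
open import Data.List using (List; []; _∷_; length)
open import Data.List.Relation.Unary.All using (All; []; _∷_)
open import Data.Nat as ℕ using (zero; suc; _<_; z≤n; s≤s)
open import Data.Nat.Combinatorics using (_C_; nCk+nC[k+1]≡[n+1]C[k+1]; nC1≡n; nCn≡1; k>n⇒nCk≡0)
open import Data.Nat.Divisibility using (_∣_; divides)
open import Data.Nat.Primality using (Prime; euclidsLemma; prime⇒irreducible; prime⇒nonTrivial; prime⇒nonZero)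
import Data.Nat.Properties as ℕ
open import Data.Product using (Σ; ∃; _×_; _,_; proj₁; proj₂)
open import Data.Sum using (_⊎_; inj₁; inj₂; [_,_]′)
open import Data.Vec using (Vec; []; _∷_; replicate)
open import Data.Vec.Functional using (Vector; removeAt)
open import Function using (_∘_; Inverse)
open import Function.Properties.Inverse using (Inverse⇒Injection)
open import Relation.Binary using (DecidableEquality; Tri; tri<; tri≈; tri>)
open import Relation.Binary.PropositionalEquality
open import Relation.Nullary using (Dec; yes; no; does)
open import Relation.Nullary.Decidable using (via-injection; dec-true; dec-false)

-- The weight is chosen to defeat carries. Using one digit on each side, say `x^((q-1)q - (q-1))`,
-- would not isolate the power `G^(q-1)`: the short words `w = (1,1)` and `w′ = (0,2)` also match,
-- because `2q + (q-1)q = 1 + q² + (q-1)`. With `h` placed on two digits of each side, a word of at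
-- most `2h` letters has just enough letters to fill both digits, and every carry would use up too
-- many of them. The bound `n ≥ 5` prevents wrap-around. The words contribute at most `(q-1)q^(n-1)`
-- to an exponent, and the weight, which lives on the digits 0 to 3, stays below `q^4 ≤ q^(n-1)`. So
-- both exponents lie below `q^n - 1`, and divisibility of their difference by `q^n - 1` means
-- equality of two natural numbers. The exponents of `x` and of `1/x` are kept apart as two natural
-- numbers, so that no exponent is ever subtracted.

module Arithmetic where

  -- Base-q digits and the values of words.

  open import Data.Nat
  open import Data.Nat.Properties
  open import Data.Nat.Divisibility
  open import Data.Nat.Solver using (module +-*-Solver)
  open +-*-Solver using (solve; _:+_; _:*_; _:=_; con)

  -- `B - A` is a multiple of `q` strictly between `-q` and `2q`, hence `0` or `q`. The second case
  -- is a carry out of the right-hand digit, which may exceed `q - 1` after `h` has been added to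
  -- it.
  carry : ∀ q {A B X Y} → A < q → B < q + q → A + X * q ≡ B + Y * q →
          (B ≡ A × X ≡ Y) ⊎ (B ≡ A + q × X ≡ suc Y)
  carry q {A} {B} {zero} {zero} A<q B<2q eq = inj₁ (sym (+-cancelʳ-≡ 0 A B eq) , refl)
  carry q {A} {B} {zero} {suc Y} A<q B<2q eq = ⊥-elim (<-irrefl refl (<-≤-trans A<q (begin
    q                  ≤⟨ m≤m+n q (Y * q) ⟩
    q + Y * q          ≤⟨ m≤n+m _ B ⟩
    B + (q + Y * q)    ≡⟨ eq ⟨
    A + 0              ≡⟨ +-identityʳ A ⟩
    A                  ∎)))
    where open ≤-Reasoning
  carry q {A} {B} {suc zero} {zero} A<q B<2q eq =
    inj₂ (trans (sym (+-identityʳ B)) (trans (sym eq) (cong (A +_) (+-identityʳ q))) , refl)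
  carry q {A} {B} {suc (suc X)} {zero} A<q B<2q eq = ⊥-elim (<-irrefl refl (<-≤-trans B<2q (begin
    q + q                    ≤⟨ +-monoʳ-≤ q (m≤m+n q (X * q)) ⟩
    q + (q + X * q)          ≤⟨ m≤n+m _ A ⟩
    A + (q + (q + X * q))    ≡⟨ eq ⟩
    B + 0                    ≡⟨ +-identityʳ B ⟩
    B                        ∎)))
    where open ≤-Reasoning
  carry q {A} {B} {suc X} {suc Y} A<q B<2q eq
    with carry q {A} {B} {X} {Y} A<q B<2q (+-cancelʳ-≡ q _ _ (trans (shift A X) (trans eq (sym (shift B Y)))))
    where
    shift : ∀ S Z → S + Z * q + q ≡ S + suc Z * q
    shift S Z = solve 3 (λ c z r → c :+ z :* r :+ r := c :+ (con 1 :+ z) :* r) refl S Z q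
  ... | inj₁ (p , r) = inj₁ (p , cong suc r)
  ... | inj₂ (p , r) = inj₂ (p , cong suc r)

  crowded : ∀ {h x y} → suc h ≤ x → h ≤ y → x + y ≤ h + h → ⊥
  crowded h<x h≤y x+y≤2h = <-irrefl refl (≤-trans (+-mono-≤ h<x h≤y) x+y≤2h)

  halves : ∀ {h x y} → h ≤ x → h ≤ y → x + y ≤ h + h → x ≡ h × y ≡ h
  halves {h} {x} {y} h≤x h≤y x+y≤2h =
    ≤-antisym (+-cancelʳ-≤ h x h (≤-trans (+-monoʳ-≤ x h≤y) x+y≤2h)) h≤x ,
    ≤-antisym (+-cancelˡ-≤ h y h (≤-trans (+-monoˡ-≤ y h≤x) x+y≤2h)) h≤y

  module PartialSums {s : ℕ} (e₀ e₁ e₂ e₃ : ℕ) (∑≤s : e₀ + e₁ + e₂ + e₃ ≤ s) where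
    ≤₀₁₂ : e₀ + e₁ + e₂ ≤ s
    ≤₀₁₂ = ≤-trans (m≤m+n _ e₃) ∑≤s
    ≤₀₁ : e₀ + e₁ ≤ s
    ≤₀₁ = ≤-trans (m≤m+n _ e₂) ≤₀₁₂
    ≤₀ : e₀ ≤ s
    ≤₀ = ≤-trans (m≤m+n _ e₁) ≤₀₁
    ≤₁ : e₁ ≤ s
    ≤₁ = ≤-trans (m≤n+m _ e₀) ≤₀₁
    ≤₂₀ : e₂ + e₀ ≤ s
    ≤₂₀ = ≤-trans (≤-reflexive (+-comm e₂ e₀)) (≤-trans (+-monoˡ-≤ e₂ (m≤m+n e₀ e₁)) ≤₀₁₂)
    ≤₂₁ : e₂ + e₁ ≤ s
    ≤₂₁ = ≤-trans (≤-reflexive (+-comm e₂ e₁)) (≤-trans (+-monoˡ-≤ e₂ (m≤n+m e₁ e₀)) ≤₀₁₂)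
    ≤₂ : e₂ ≤ s
    ≤₂ = ≤-trans (m≤m+n _ e₀) ≤₂₀
    ≤₀₃ : e₀ + e₃ ≤ s
    ≤₀₃ = ≤-trans (+-monoˡ-≤ e₃ (≤-trans (m≤m+n e₀ e₁) (m≤m+n _ e₂))) ∑≤s
    ≤₁₃ : e₁ + e₃ ≤ s
    ≤₁₃ = ≤-trans (+-monoˡ-≤ e₃ (≤-trans (m≤n+m e₁ e₀) (m≤m+n _ e₂))) ∑≤s
    ≤₂₃ : e₂ + e₃ ≤ s
    ≤₂₃ = ≤-trans (+-monoˡ-≤ e₃ (m≤n+m e₂ (e₀ + e₁))) ∑≤s
    ≤₃₀ : e₃ + e₀ ≤ s
    ≤₃₀ = ≤-trans (≤-reflexive (+-comm e₃ e₀)) ≤₀₃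
    ≤₃₁ : e₃ + e₁ ≤ s
    ≤₃₁ = ≤-trans (≤-reflexive (+-comm e₃ e₁)) ≤₁₃
    ≤₃ : e₃ ≤ s
    ≤₃ = ≤-trans (m≤m+n _ e₀) ≤₃₀

  -- Only the digits d₀, ..., d₃ are separated; X collects the rest.
  horner : ℕ → ℕ → ℕ → ℕ → ℕ → ℕ → ℕ
  horner q d₀ d₁ d₂ d₃ X = d₀ + (d₁ + (d₂ + (d₃ + X * q) * q) * q) * q

  module _ (k : ℕ) where
    private
      h q : ℕ
      h = suc k
      q = suc (h + h)

    module _ {e₀ e₁ e₂ e₃ X f₀ f₁ f₂ f₃ Y : ℕ}
      (e≤ : e₀ + e₁ + e₂ + e₃ ≤ h + h) (f≤ : f₀ + f₁ + f₂ + f₃ ≤ h + h)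
      (eq : horner q e₀ e₁ (e₂ + h) (e₃ + h) X ≡ horner q (f₀ + h) (f₁ + h) f₂ f₃ Y) where

      private
        module E = PartialSums e₀ e₁ e₂ e₃ e≤
        module F = PartialSums f₀ f₁ f₂ f₃ f≤

        <2q : ∀ {x} → x ≤ suc (h + h + h) → x < q + q
        <2q {x} x≤ = s≤s (begin
          x                      ≤⟨ x≤ ⟩
          suc (h + h + h)        ≤⟨ s≤s (+-monoʳ-≤ (h + h) (m≤m+n h h)) ⟩
          suc (h + h + (h + h))  ≡⟨ +-suc (h + h) (h + h) ⟨
          h + h + q              ∎)
          where open ≤-Reasoning

        conclude : h ≤ e₀ → h ≤ e₁ → h ≤ f₂ → h ≤ f₃ → (e₀ ≡ h × e₁ ≡ h) × (f₂ ≡ h × f₃ ≡ h)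
        conclude a b c d = halves a b E.≤₀₁ , halves c d F.≤₂₃

        -- `c` is the carry arriving from digit 1. A carry out of digit 2 would need `c + f₂ > q`,
        -- and one out of digit 3 would need `f₃ ≥ q`; both exceed what `2h = q - 1` letters allow.
        upper : ∀ c → c ≤ 1 → e₂ ≤ h → e₃ ≤ h →
                e₂ + h + (e₃ + h + X * q) * q ≡ c + f₂ + (f₃ + Y * q) * q →
                c + f₂ ≡ e₂ + h × f₃ ≡ e₃ + h
        upper c c≤1 e₂≤h e₃≤h eq
          with carry q (s≤s (+-monoˡ-≤ h e₂≤h))
                 (<2q (≤-trans (+-mono-≤ c≤1 F.≤₂) (s≤s (m≤m+n (h + h) h)))) eq
        ... | inj₂ (p , _) = ⊥-elim (<-irrefl refl (begin-strict
                c + f₂        ≤⟨ +-mono-≤ c≤1 F.≤₂ ⟩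
                q             <⟨ m<n+m q (≤-trans (s≤s z≤n) (m≤n+m h e₂)) ⟩
                e₂ + h + q    ≡⟨ p ⟨
                c + f₂        ∎))
                where open ≤-Reasoning
        ... | inj₁ (p , r)
          with carry q {e₃ + h} {f₃} {X} {Y} (s≤s (+-monoˡ-≤ h e₃≤h)) (<2q (≤-trans F.≤₃ (≤-trans (m≤m+n (h + h) h) (n≤1+n _)))) r
        ... | inj₁ (p′ , _) = p , p′
        ... | inj₂ (p′ , _) = ⊥-elim (<-irrefl refl (≤-trans (≤-trans (m≤n+m q (e₃ + h)) (≤-reflexive (sym p′))) F.≤₃))

        small : ∀ {x y} → h ≤ y → x + y ≤ h + h → x ≤ h
        small {x} h≤y x+y≤2h = +-cancelʳ-≤ h x h (≤-trans (+-monoʳ-≤ x h≤y) x+y≤2h)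

        ≥h : ∀ {x} y → x ≡ y + h → h ≤ x
        ≥h y refl = m≤n+m h y

        borrow : ∀ x y z → x + h ≡ y + suc (z + h) → suc z ≤ x
        borrow x y z p = +-cancelʳ-≤ h (suc z) x (≤-trans (m≤n+m (suc (z + h)) y) (≤-reflexive (sym p)))

      -- A carry out of digit 0 or 1 means f₀ > h or f₁ > h, so at most one of them occurs, and the other digit shows
      -- that e₀ ≥ h or e₁ ≥ h. Hence e₂, e₃ ≤ h, so digits 2 and 3 produce no carry. Then f₃ ≥ h, which excludes the
      -- carries out of digits 0 and 1 as well.
      digits : (e₀ ≡ h × e₁ ≡ h) × (f₂ ≡ h × f₃ ≡ h)
      digits with carry q (s≤s E.≤₀) (<2q (≤-trans (+-monoˡ-≤ h F.≤₀) (n≤1+n _))) eq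
      digits | inj₁ (p₀ , r₀) with carry q (s≤s E.≤₁) (<2q (≤-trans (+-monoˡ-≤ h F.≤₁) (n≤1+n _))) r₀
      digits | inj₁ (p₀ , r₀) | inj₁ (p₁ , r₁)
        with upper 0 z≤n (small (≥h f₀ (sym p₀)) E.≤₂₀) (small (≥h f₀ (sym p₀)) E.≤₃₀) r₁
      ... | p₂ , p₃ = conclude (≥h f₀ (sym p₀)) (≥h f₁ (sym p₁)) (≥h e₂ p₂) (≥h e₃ p₃)
      digits | inj₁ (p₀ , r₀) | inj₂ (p₁ , r₁)
        with upper 1 ≤-refl (small (≥h f₀ (sym p₀)) E.≤₂₀) (small (≥h f₀ (sym p₀)) E.≤₃₀) r₁
      ... | p₂ , p₃ = ⊥-elim (crowded (borrow f₁ e₁ h p₁) (≥h e₃ p₃) F.≤₁₃)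
      digits | inj₂ (p₀ , r₀) with carry q (s≤s E.≤₁) (<2q (s≤s (+-monoˡ-≤ h F.≤₁))) r₀
      digits | inj₂ (p₀ , r₀) | inj₁ (p₁ , r₁)
        with upper 0 z≤n (small (≥h (suc f₁) (sym p₁)) E.≤₂₁) (small (≥h (suc f₁) (sym p₁)) E.≤₃₁) r₁
      ... | p₂ , p₃ = ⊥-elim (crowded (borrow f₀ e₀ h p₀) (≥h e₃ p₃) F.≤₀₃)
      digits | inj₂ (p₀ , r₀) | inj₂ (p₁ , r₁) =
        -- Digit 1 has received a carry, so its own carry yields only `h ≤ f₁`; with `f₀ > h` this
        -- is still too much.
        ⊥-elim (crowded (borrow f₀ e₀ h p₀) (≤-pred (borrow (suc f₁) e₁ h p₁)) F.≤₀₁)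

  val : ℕ → List ℕ → ℕ
  val q []      = 0
  val q (i ∷ w) = q ^ i + val q w

  -- The Boolean test computes on the literal letters 0 to 3, so in the case analyses below the
  -- counts reduce by evaluation.
  count : ℕ → List ℕ → ℕ
  count α []      = 0
  count α (i ∷ w) = if i ≡ᵇ α then suc (count α w) else count α w

  tailVal : ℕ → List ℕ → ℕ
  tailVal q [] = 0
  tailVal q (suc (suc (suc (suc i))) ∷ w) = q ^ i + tailVal q w
  tailVal q (_ ∷ w) = tailVal q w

  val-horner : ∀ q w → val q w ≡ horner q (count 0 w) (count 1 w) (count 2 w) (count 3 w) (tailVal q w)
  val-horner q [] = refl
  val-horner q (i ∷ w) = trans (cong (q ^ i +_) (val-horner q w)) (step i)
    where
    step : ∀ i → q ^ i + horner q (count 0 w) (count 1 w) (count 2 w) (count 3 w) (tailVal q w) ≡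
           horner q (count 0 (i ∷ w)) (count 1 (i ∷ w)) (count 2 (i ∷ w)) (count 3 (i ∷ w)) (tailVal q (i ∷ w))
    step 0 = refl
    step 1 = solve 6 (λ q a b c d t → q :* con 1 :+ (a :+ (b :+ (c :+ (d :+ t :* q) :* q) :* q) :* q)
               := a :+ (con 1 :+ b :+ (c :+ (d :+ t :* q) :* q) :* q) :* q)
               refl q (count 0 w) (count 1 w) (count 2 w) (count 3 w) (tailVal q w)
    step 2 = solve 6 (λ q a b c d t → q :* (q :* con 1) :+ (a :+ (b :+ (c :+ (d :+ t :* q) :* q) :* q) :* q)
               := a :+ (b :+ (con 1 :+ c :+ (d :+ t :* q) :* q) :* q) :* q)
               refl q (count 0 w) (count 1 w) (count 2 w) (count 3 w) (tailVal q w)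
    step 3 = solve 6 (λ q a b c d t → q :* (q :* (q :* con 1)) :+ (a :+ (b :+ (c :+ (d :+ t :* q) :* q) :* q) :* q)
               := a :+ (b :+ (c :+ (con 1 :+ d :+ t :* q) :* q) :* q) :* q)
               refl q (count 0 w) (count 1 w) (count 2 w) (count 3 w) (tailVal q w)
    step (suc (suc (suc (suc i)))) =
      solve 7 (λ q a b c d t u → q :* (q :* (q :* (q :* u))) :+ (a :+ (b :+ (c :+ (d :+ t :* q) :* q) :* q) :* q)
               := a :+ (b :+ (c :+ (d :+ (u :+ t) :* q) :* q) :* q) :* q)
               refl q (count 0 w) (count 1 w) (count 2 w) (count 3 w) (tailVal q w) (q ^ i)

  counts≤length : ∀ w → count 0 w + count 1 w + count 2 w + count 3 w ≤ length w
  counts≤length [] = z≤n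
  counts≤length (i ∷ w) = step i (counts≤length w)
    where
    step : ∀ i → count 0 w + count 1 w + count 2 w + count 3 w ≤ length w →
           count 0 (i ∷ w) + count 1 (i ∷ w) + count 2 (i ∷ w) + count 3 (i ∷ w) ≤ suc (length w)
    step 0 p = s≤s p
    step 1 p = ≤-trans (≤-reflexive (solve 4 (λ a b c d → a :+ (con 1 :+ b) :+ c :+ d := con 1 :+ (a :+ b :+ c :+ d))
               refl (count 0 w) (count 1 w) (count 2 w) (count 3 w))) (s≤s p)
    step 2 p = ≤-trans (≤-reflexive (solve 4 (λ a b c d → a :+ b :+ (con 1 :+ c) :+ d := con 1 :+ (a :+ b :+ c :+ d))
               refl (count 0 w) (count 1 w) (count 2 w) (count 3 w))) (s≤s p)
    step 3 p = ≤-trans (≤-reflexive (+-suc (count 0 w + count 1 w + count 2 w) (count 3 w))) (s≤s p)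
    step (suc (suc (suc (suc i)))) p = m≤n⇒m≤1+n p

  val-bound : ∀ q m .{{_ : NonZero q}} {w} → All (_< suc m) w → val q w ≤ length w * q ^ m
  val-bound q m []       = z≤n
  val-bound q m (i<n ∷ a) = +-mono-≤ (^-monoʳ-≤ q (≤-pred i<n)) (val-bound q m a)

  -- The weight raises digits 2 and 3 on the side of `w` and digits 0 and 1 on the side of `w′` by
  -- `h`, which puts the equation into the Horner form of `digits`.
  digits-of-words : ∀ {q} k → let h = suc k in q ≡ suc (h + h) → ∀ w w′ →
    length w ≤ h + h → length w′ ≤ h + h →
    val q w + (h * q ^ 2 + h * q ^ 3) ≡ val q w′ + (h * q ^ 0 + h * q ^ 1) →
    (count 0 w ≡ h × count 1 w ≡ h) × (count 2 w′ ≡ h × count 3 w′ ≡ h)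
  digits-of-words k refl w w′ l≤ l′≤ eq = digits k {X = tailVal _ w} {f₀ = count 0 w′} {f₁ = count 1 w′} {Y = tailVal _ w′}
    (≤-trans (counts≤length w) l≤) (≤-trans (counts≤length w′) l′≤)
    (trans (sym left) (trans eq right))
    where
    h = suc k
    q = suc (h + h)
    left : val q w + (h * q ^ 2 + h * q ^ 3) ≡
           horner q (count 0 w) (count 1 w) (count 2 w + h) (count 3 w + h) (tailVal q w)
    left = trans (cong (_+ (h * q ^ 2 + h * q ^ 3)) (val-horner q w))
      (solve 7 (λ q h a b c d t →
         (a :+ (b :+ (c :+ (d :+ t :* q) :* q) :* q) :* q) :+ (h :* (q :* (q :* con 1)) :+ h :* (q :* (q :* (q :* con 1))))
         := a :+ (b :+ (c :+ h :+ (d :+ h :+ t :* q) :* q) :* q) :* q)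
        refl q h (count 0 w) (count 1 w) (count 2 w) (count 3 w) (tailVal q w))
    right : val q w′ + (h * q ^ 0 + h * q ^ 1) ≡
           horner q (count 0 w′ + h) (count 1 w′ + h) (count 2 w′) (count 3 w′) (tailVal q w′)
    right = trans (cong (_+ (h * q ^ 0 + h * q ^ 1)) (val-horner q w′))
      (solve 7 (λ q h a b c d t →
         (a :+ (b :+ (c :+ (d :+ t :* q) :* q) :* q) :* q) :+ (h :* con 1 :+ h :* (q :* con 1))
         := a :+ h :+ (b :+ h :+ (c :+ (d :+ t :* q) :* q) :* q) :* q)
        refl q h (count 0 w′) (count 1 w′) (count 2 w′) (count 3 w′) (tailVal q w′))

  -- The letters account for at most `2h * q^(n-1)`, which leaves one full `q^(n-1) ≥ q^4` for the
  -- weight. The conclusion says that the exponent is at most `q^n - 2`, so distinct exponents stay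
  -- distinct modulo `q^n - 1`.
  exponent-bound : ∀ {q n} k → let h = suc k in q ≡ suc (h + h) → 5 ≤ n → ∀ {w} →
    length w ≤ h + h → All (_< n) w → ∀ {T} → T ≤ h * q ^ 2 + h * q ^ 3 →
    suc (suc (val q w + T)) ≤ q ^ n
  exponent-bound {n = suc m} k refl (s≤s 4≤m) {w} l≤ a {T} T≤ = begin
    suc (suc (val q w + T))    ≡⟨ cong suc (+-suc (val q w) T) ⟨
    suc (val q w + suc T)      ≡⟨ +-suc (val q w) (suc T) ⟨
    val q w + suc (suc T)      ≤⟨ +-mono-≤ (≤-trans (val-bound q m a) (*-monoˡ-≤ (q ^ m) l≤)) top ⟩
    (h + h) * q ^ m + q ^ m    ≡⟨ +-comm _ (q ^ m) ⟩
    q ^ suc m                  ∎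
    where
    open ≤-Reasoning
    h = suc k
    q = suc (h + h)
    slack : suc (suc (h * q ^ 2 + h * q ^ 3)) ≤ q ^ 4
    slack = begin
      2 + (h * q ^ 2 + h * q ^ 3)          ≤⟨ +-mono-≤ (≤-trans (s≤s (s≤s z≤n)) (^-monoʳ-≤ q {1} {3} (s≤s z≤n)))
                                                (+-monoˡ-≤ (h * q ^ 3) (*-monoʳ-≤ h (^-monoʳ-≤ q {2} {3} (n≤1+n 2)))) ⟩
      q ^ 3 + (h * q ^ 3 + h * q ^ 3)      ≡⟨ cong (q ^ 3 +_) (*-distribʳ-+ (q ^ 3) h h) ⟨
      q ^ 4                                ∎
    top : suc (suc T) ≤ q ^ m
    top = begin
      suc (suc T)                           ≤⟨ s≤s (s≤s T≤) ⟩
      suc (suc (h * q ^ 2 + h * q ^ 3))     ≤⟨ slack ⟩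
      q ^ 4                                 ≤⟨ ^-monoʳ-≤ q 4≤m ⟩
      q ^ m                                 ∎

  lower≤upper : ∀ q .{{_ : NonZero q}} h → h * q ^ 0 + h * q ^ 1 ≤ h * q ^ 2 + h * q ^ 3
  lower≤upper q h = +-mono-≤ (*-monoʳ-≤ h (^-monoʳ-≤ q {0} {2} z≤n)) (*-monoʳ-≤ h (^-monoʳ-≤ q {1} {3} (s≤s z≤n)))

  count-≡ : ∀ α w → count α (α ∷ w) ≡ suc (count α w)
  count-≡ α w = cong (if_then suc (count α w) else count α w) (dec-true (α ≟ α) refl)

  count-≢ : ∀ {i α} w → i ≢ α → count α (i ∷ w) ≡ count α w
  count-≢ {i} {α} w i≢α = cong (if_then suc (count α w) else count α w) (dec-false (i ≟ α) i≢α)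

  count₂≤length : ∀ {α β} → α ≢ β → ∀ w → count α w + count β w ≤ length w
  count₂≤length α≢β [] = z≤n
  count₂≤length {α} {β} α≢β (i ∷ w) with i ≟ α | i ≟ β
  ... | yes refl | yes refl = ⊥-elim (α≢β refl)
  ... | yes refl | no i≢β rewrite count-≡ i w | count-≢ w i≢β = s≤s (count₂≤length α≢β w)
  ... | no i≢α | yes refl rewrite count-≡ i w | count-≢ w i≢α =
    ≤-trans (≤-reflexive (+-suc (count α w) (count i w))) (s≤s (count₂≤length α≢β w))
  ... | no i≢α | no i≢β rewrite count-≢ w i≢α | count-≢ w i≢β = m≤n⇒m≤1+n (count₂≤length α≢β w)

  -- Binomial coefficients modulo p, and the parity of q.

  absorption : ∀ n k → suc k * (suc n C suc k) ≡ suc n * (n C k)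
  absorption n       zero    = trans (*-identityˡ _) (trans (nC1≡n (suc n)) (sym (*-identityʳ _)))
  absorption zero    (suc k) = trans (*-zeroʳ (suc (suc k))) refl
  absorption (suc n) (suc k) = begin
    suc (suc k) * (suc (suc n) C suc (suc k))
      ≡⟨ cong (suc (suc k) *_) (nCk+nC[k+1]≡[n+1]C[k+1] (suc n) (suc k)) ⟨
    suc (suc k) * (suc n C suc k + suc n C suc (suc k))
      ≡⟨ *-distribˡ-+ (suc (suc k)) (suc n C suc k) _ ⟩
    suc n C suc k + suc k * (suc n C suc k) + suc (suc k) * (suc n C suc (suc k))
      ≡⟨ cong₂ (λ x y → suc n C suc k + x + y) (absorption n k) (absorption n (suc k)) ⟩
    suc n C suc k + suc n * (n C k) + suc n * (n C suc k)
      ≡⟨ +-assoc (suc n C suc k) _ _ ⟩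
    suc n C suc k + (suc n * (n C k) + suc n * (n C suc k))
      ≡⟨ cong (suc n C suc k +_) (*-distribˡ-+ (suc n) (n C k) _) ⟨
    suc n C suc k + suc n * (n C k + n C suc k)
      ≡⟨ cong (λ x → suc n C suc k + suc n * x) (nCk+nC[k+1]≡[n+1]C[k+1] n k) ⟩
    suc (suc n) * (suc n C suc k) ∎
    where open ≡-Reasoning

  primePower∣*⇒∣ : ∀ {p c} → Prime p → ¬ (p ∣ c) → ∀ k i → p ^ k ∣ i * c → p ^ k ∣ i
  primePower∣*⇒∣ pr p∤c zero i _ = 1∣ i
  primePower∣*⇒∣ {p} {c} pr p∤c (suc k) i d with euclidsLemma i c pr (∣-trans (m∣m*n (p ^ k)) d)
  ... | inj₂ p∣c = ⊥-elim (p∤c p∣c)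
  ... | inj₁ (divides i′ refl) =
    subst (p ^ suc k ∣_) (*-comm p i′) (*-monoʳ-∣ p (primePower∣*⇒∣ pr p∤c k i′
      (*-cancelˡ-∣ p {{prime⇒nonZero pr}} (subst (p ^ suc k ∣_)
        (trans (cong (_* c) (*-comm i′ p)) (*-assoc p i′ c)) d))))

  -- By absorption `q` divides `i * (q C i)`. If `p` did not divide `q C i`, then the prime power
  -- `q` would divide `i`, which is impossible for `0 < i < q`.
  prime∣binomial : ∀ {p} → Prime p → ∀ k {q} → q ≡ p ^ k → ∀ i → 0 < i → i < q → p ∣ q C i
  prime∣binomial {p} pr k {suc q} eq (suc i) _ i<q with p ∣? (suc q C suc i)
  ... | yes d = d
  ... | no p∤ = ⊥-elim (<-irrefl refl (<-≤-trans i<q (∣⇒≤ (subst (_∣ suc i) (sym eq)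
          (primePower∣*⇒∣ pr p∤ k (suc i) (subst (_∣ suc i * (suc q C suc i)) eq
            (subst (suc q ∣_) (sym (absorption q i)) (m∣m*n (q C i)))))))))

  odd-product : ∀ a b → suc (a + a) * suc (b + b) ≡ suc ((a + b + (a * b + a * b)) + (a + b + (a * b + a * b)))
  odd-product = solve 2 (λ a b → (con 1 :+ (a :+ a)) :* (con 1 :+ (b :+ b))
     := con 1 :+ ((a :+ b :+ (a :* b :+ a :* b)) :+ (a :+ b :+ (a :* b :+ a :* b)))) refl

  even-or-odd : ∀ m → (∃ λ h → m ≡ h + h) ⊎ (∃ λ h → m ≡ suc (h + h))
  even-or-odd zero = inj₁ (0 , refl)
  even-or-odd (suc m) with even-or-odd m
  ... | inj₁ (h , refl) = inj₂ (h , refl)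
  ... | inj₂ (h , refl) = inj₁ (suc h , cong suc (sym (+-suc h h)))

  odd-power : ∀ a k → ∃ λ h → suc (a + a) ^ k ≡ suc (h + h)
  odd-power a zero = 0 , refl
  odd-power a (suc k) with odd-power a k
  ... | b , eq = a + b + (a * b + a * b) , trans (cong (suc (a + a) *_) eq) (odd-product a b)

  prime≡2∨odd-power : ∀ {p} → Prime p → ∀ k → p ≡ 2 ⊎ ∃ λ h → p ^ k ≡ suc (h + h)
  prime≡2∨odd-power {p} pr k with even-or-odd p
  ... | inj₂ (a , refl) = inj₂ (odd-power a k)
  ... | inj₁ (a , refl) with prime⇒irreducible pr (divides a (trans (cong (a +_) (sym (+-identityʳ a))) (*-comm 2 a)))
  ...   | inj₁ ()
  ...   | inj₂ 2≡p = inj₁ (sym 2≡p)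

open Arithmetic

module _ (M : CommutativeMonoid 0ℓ 0ℓ) where
  private module M = CommutativeMonoid M
  open import Algebra.Properties.CommutativeMonoid.Sum M
  open import Relation.Binary.Reasoning.Setoid M.setoid

  -- Stated for commutative monoids so as to serve both sums and products over the field.
  sum-single : ∀ {n} (t : Vector M.Carrier n) i → (∀ j → j ≢ i → t j M.≈ M.ε) → sum t M.≈ t i
  sum-single {suc n} t i vanish = begin
    sum t                                ≈⟨ sum-remove t ⟩
    t i M.∙ sum (removeAt t i)           ≈⟨ M.∙-congˡ (sum-cong-≋ (λ j → vanish (punchIn i j) (Fin.punchInᵢ≢i i j))) ⟩
    t i M.∙ sum {n} (λ _ → M.ε)          ≈⟨ M.∙-congˡ (sum-replicate-zero n) ⟩
    t i M.∙ M.ε                          ≈⟨ M.identityʳ (t i) ⟩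
    t i                                  ∎

-- Finite fields: inverses, Fermat's theorem, roots of polynomials, power sums.

module FieldTheory {N : ℕ} (K : FiniteField N) where
  open FiniteField K hiding (_-_)

  ring : CommutativeRing 0ℓ 0ℓ
  ring = record { isCommutativeRing = isCommutativeRing }

  open CommutativeRing ring using
    (_-_; +-assoc; +-identityˡ; +-identityʳ; -‿inverseʳ; -‿inverseˡ; *-assoc; *-comm; *-identityˡ; *-identityʳ; zeroˡ; zeroʳ; distribˡ; +-commutativeMonoid; *-commutativeMonoid; commutativeSemiring; semiring)
  open import Algebra.Properties.Ring (CommutativeRing.ring ring)
    using (+-cancelˡ)
  open import Algebra.Properties.CommutativeSemiring.Exp commutativeSemiring
    using (^-homo-*; ^-distrib-*) renaming (_^_ to _^ˢ_)
  open import Algebra.Properties.Semiring.Mult semiring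
    using () renaming (_×_ to _·_)
  import Algebra.Properties.CommutativeMonoid.Sum +-commutativeMonoid as ∑
  import Algebra.Properties.CommutativeMonoid.Sum *-commutativeMonoid as ∏
  import Algebra.Properties.Semiring.Sum semiring as SSum
  open import Algebra.Solver.Ring.NaturalCoefficients.Default commutativeSemiring
    using (solve; _:+_; _:*_; _:=_; con)
  open ≡-Reasoning

  open Inverse card using (to; from; strictlyInverseˡ; strictlyInverseʳ)

  abstract
    _≟_ : DecidableEquality Carrier
    _≟_ = via-injection (Inverse⇒Injection card) Fin._≟_

  1≢0 : 1# ≢ 0#
  1≢0 = 0≢1 ∘ sym

  -1≢0 : - 1# ≢ 0#
  -1≢0 eq = 1≢0 (trans (sym (+-identityʳ 1#)) (trans (cong (1# +_) (sym eq)) (-‿inverseʳ 1#)))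

  *-cancel-nonzero : ∀ {x y z} → x ≢ 0# → x * y ≡ x * z → y ≡ z
  *-cancel-nonzero {x} {y} {z} x≢0 eq = let (x⁻¹ , inv) = inverse x x≢0 in begin
    y               ≡⟨ *-identityˡ y ⟨
    1# * y          ≡⟨ cong (_* y) inv ⟨
    x * x⁻¹ * y     ≡⟨ solve 3 (λ a b c → a :* b :* c := b :* (a :* c)) refl x x⁻¹ y ⟩
    x⁻¹ * (x * y)   ≡⟨ cong (x⁻¹ *_) eq ⟩
    x⁻¹ * (x * z)   ≡⟨ solve 3 (λ a b c → b :* (a :* c) := a :* b :* c) refl x x⁻¹ z ⟩
    x * x⁻¹ * z     ≡⟨ cong (_* z) inv ⟩
    1# * z          ≡⟨ *-identityˡ z ⟩
    z               ∎

  *-nonzero : ∀ {x y} → x ≢ 0# → y ≢ 0# → x * y ≢ 0#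
  *-nonzero {x} x≢0 y≢0 xy≡0 = y≢0 (*-cancel-nonzero x≢0 (trans xy≡0 (sym (zeroʳ x))))

  ^-nonzero : ∀ {x} n → x ≢ 0# → x ^ˢ n ≢ 0#
  ^-nonzero zero    x≢0 = 1≢0
  ^-nonzero (suc n) x≢0 = *-nonzero x≢0 (^-nonzero n x≢0)

  1^n≡1 : ∀ n → 1# ^ˢ n ≡ 1#
  1^n≡1 zero    = refl
  1^n≡1 (suc n) = trans (*-identityˡ _) (1^n≡1 n)

  *-cancelʳ-or : ∀ x y z → x * z ≡ y * z → x ≢ y → z ≡ 0#
  *-cancelʳ-or x y z eq x≢y with z ≟ 0#
  ... | yes p = p
  ... | no  z≢0 = ⊥-elim (x≢y (*-cancel-nonzero z≢0 (trans (*-comm z x) (trans eq (*-comm y z)))))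

  -- The value `0#` at `0#` makes `inv-*` hold for every `x`.
  inv : Carrier → Carrier
  inv x with x ≟ 0#
  ... | yes _  = 0#
  ... | no x≢0 = proj₁ (inverse x x≢0)

  *-inv : ∀ {x} → x ≢ 0# → x * inv x ≡ 1#
  *-inv {x} x≢0 with x ≟ 0#
  ... | yes x≡0 = ⊥-elim (x≢0 x≡0)
  ... | no x≢0′ = proj₂ (inverse x x≢0′)

  inv-zero : inv 0# ≡ 0#
  inv-zero with 0# ≟ 0#
  ... | yes _  = refl
  ... | no 0≢0 = ⊥-elim (0≢0 refl)

  inv-* : ∀ {g} x → g ≢ 0# → inv (g * x) ≡ inv g * inv x
  inv-* {g} x g≢0 = go (x ≟ 0#)
    where
    go : Dec (x ≡ 0#) → inv (g * x) ≡ inv g * inv x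
    go (yes refl) = begin
      inv (g * 0#)      ≡⟨ cong inv (zeroʳ g) ⟩
      inv 0#            ≡⟨ inv-zero ⟩
      0#                ≡⟨ zeroʳ (inv g) ⟨
      inv g * 0#        ≡⟨ cong (inv g *_) inv-zero ⟨
      inv g * inv 0#    ∎
    go (no x≢0) = *-cancel-nonzero (*-nonzero g≢0 x≢0) (begin
      g * x * inv (g * x)         ≡⟨ *-inv (*-nonzero g≢0 x≢0) ⟩
      1#                          ≡⟨ *-identityˡ 1# ⟨
      1# * 1#                     ≡⟨ cong₂ _*_ (*-inv g≢0) (*-inv x≢0) ⟨
      g * inv g * (x * inv x)     ≡⟨ solve 4 (λ a b c d → a :* b :* (c :* d) := a :* c :* (b :* d)) refl g (inv g) x (inv x) ⟩
      g * x * (inv g * inv x)     ∎)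

  ∑ᴷ ∏ᴷ : (Carrier → Carrier) → Carrier
  ∑ᴷ f = ∑.sum (f ∘ from)
  ∏ᴷ f = ∏.sum (f ∘ from)

  ∑ᴷ-cong : ∀ {f g} → (∀ x → f x ≡ g x) → ∑ᴷ f ≡ ∑ᴷ g
  ∑ᴷ-cong eq = ∑.sum-cong-≗ (eq ∘ from)

  ∑ᴷ-distrib-+ : ∀ f g → ∑ᴷ (λ x → f x + g x) ≡ ∑ᴷ f + ∑ᴷ g
  ∑ᴷ-distrib-+ f g = ∑.∑-distrib-+ (f ∘ from) (g ∘ from)

  ∑ᴷ-*ˡ : ∀ c f → ∑ᴷ (λ x → c * f x) ≡ c * ∑ᴷ f
  ∑ᴷ-*ˡ c f = sym (SSum.*-distribˡ-sum c (f ∘ from))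

  ∑ᴷ-zero : ∑ᴷ (λ _ → 0#) ≡ 0#
  ∑ᴷ-zero = ∑.sum-replicate-zero N

  module _ (σ τ : Carrier → Carrier) (στ : ∀ x → σ (τ x) ≡ x) (τσ : ∀ x → τ (σ x) ≡ x) where
    private
      π = permutation (to ∘ σ ∘ from) (to ∘ τ ∘ from)
            (λ i → trans (cong (to ∘ σ) (strictlyInverseʳ _)) (trans (cong to (στ _)) (strictlyInverseˡ i)))
            (λ i → trans (cong (to ∘ τ) (strictlyInverseʳ _)) (trans (cong to (τσ _)) (strictlyInverseˡ i)))

    ∑ᴷ-reindex : ∀ f → ∑ᴷ f ≡ ∑ᴷ (f ∘ σ)
    ∑ᴷ-reindex f = trans (∑.sum-permute (f ∘ from) π) (∑.sum-cong-≗ {x = f ∘ from ∘ to ∘ σ ∘ from} {y = f ∘ σ ∘ from} (λ i → cong f (strictlyInverseʳ _)))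

    ∏ᴷ-reindex : ∀ f → ∏ᴷ f ≡ ∏ᴷ (f ∘ σ)
    ∏ᴷ-reindex f = trans (∏.sum-permute (f ∘ from) π) (∏.sum-cong-≗ {x = f ∘ from ∘ to ∘ σ ∘ from} {y = f ∘ σ ∘ from} (λ i → cong f (strictlyInverseʳ _)))

  module _ {g} (g≢0 : g ≢ 0#) where
    private
      scale-inv : ∀ x → g * (inv g * x) ≡ x
      scale-inv x = trans (sym (*-assoc g (inv g) x)) (trans (cong (_* x) (*-inv g≢0)) (*-identityˡ x))
      inv-scale : ∀ x → inv g * (g * x) ≡ x
      inv-scale x = trans (solve 3 (λ a b c → b :* (a :* c) := a :* (b :* c)) refl g (inv g) x) (scale-inv x)

    ∑ᴷ-scale : ∀ f → ∑ᴷ f ≡ ∑ᴷ (λ x → f (g * x))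
    ∑ᴷ-scale = ∑ᴷ-reindex (g *_) (inv g *_) scale-inv inv-scale

    ∏ᴷ-scale : ∀ f → ∏ᴷ f ≡ ∏ᴷ (λ x → f (g * x))
    ∏ᴷ-scale = ∏ᴷ-reindex (g *_) (inv g *_) scale-inv inv-scale

  -- Sums and products over `K*` are taken over all of `K`, with the neutral element as value at
  -- `0#`.
  at0 : Carrier → Carrier → Carrier → Carrier
  at0 a b x = if does (x ≟ 0#) then a else b

  at0-zero : ∀ a b → at0 a b 0# ≡ a
  at0-zero a b with 0# ≟ 0#
  ... | yes _ = refl
  ... | no ¬p = ⊥-elim (¬p refl)

  at0-nonzero : ∀ a b {x} → x ≢ 0# → at0 a b x ≡ b
  at0-nonzero a b {x} x≢0 with x ≟ 0#
  ... | yes p = ⊥-elim (x≢0 p)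
  ... | no _  = refl

  from≢0 : ∀ i → i ≢ to 0# → from i ≢ 0#
  from≢0 i i≢ eq = i≢ (trans (sym (strictlyInverseˡ i)) (cong to eq))

  ∑ᴷ-at0 : ∀ a → ∑ᴷ (at0 a 0#) ≡ a
  ∑ᴷ-at0 a = trans (sum-single +-commutativeMonoid (at0 a 0# ∘ from) (to 0#) (λ i i≢ → at0-nonzero a 0# (from≢0 i i≢)))
    (trans (cong (at0 a 0#) (strictlyInverseʳ 0#)) (at0-zero a 0#))

  ∏ᴷ-at0 : ∀ a → ∏ᴷ (at0 a 1#) ≡ a
  ∏ᴷ-at0 a = trans (sum-single *-commutativeMonoid (at0 a 1# ∘ from) (to 0#) (λ i i≢ → at0-nonzero a 1# (from≢0 i i≢)))
    (trans (cong (at0 a 1#) (strictlyInverseʳ 0#)) (at0-zero a 1#))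

  -- Translation by 1 permutes K, so N · 1# does not change the sum of all elements.
  N·1≡0 : N · 1# ≡ 0#
  N·1≡0 = +-cancelˡ (∑ᴷ (λ x → x)) (N · 1#) 0# (begin
    ∑ᴷ (λ x → x) + N · 1#          ≡⟨ cong (∑ᴷ (λ x → x) +_) (∑.sum-replicate N) ⟨
    ∑ᴷ (λ x → x) + ∑ᴷ (λ _ → 1#)   ≡⟨ ∑ᴷ-distrib-+ (λ x → x) (λ _ → 1#) ⟨
    ∑ᴷ (λ x → x + 1#)              ≡⟨ ∑ᴷ-reindex (_+ 1#) (_+ - 1#)
                                        (λ x → trans (+-assoc x _ _) (trans (cong (x +_) (-‿inverseˡ 1#)) (+-identityʳ x)))
                                        (λ x → trans (+-assoc x _ _) (trans (cong (x +_) (-‿inverseʳ 1#)) (+-identityʳ x)))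
                                        (λ x → x) ⟨
    ∑ᴷ (λ x → x)                   ≡⟨ +-identityʳ _ ⟨
    ∑ᴷ (λ x → x) + 0#              ∎)

  -- `K*` has `N - 1` elements, and `N · 1# ≡ 0#`.
  ∑ᴷ-nonzero : ∑ᴷ (at0 0# 1#) ≡ - 1#
  ∑ᴷ-nonzero = +-cancelˡ 1# _ _ (begin
    1# + ∑ᴷ (at0 0# 1#)                   ≡⟨ cong (_+ ∑ᴷ (at0 0# 1#)) (∑ᴷ-at0 1#) ⟨
    ∑ᴷ (at0 1# 0#) + ∑ᴷ (at0 0# 1#)       ≡⟨ ∑ᴷ-distrib-+ (at0 1# 0#) (at0 0# 1#) ⟨
    ∑ᴷ (λ x → at0 1# 0# x + at0 0# 1# x)  ≡⟨ ∑ᴷ-cong split ⟩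
    ∑ᴷ (λ _ → 1#)                         ≡⟨ ∑.sum-replicate N ⟩
    N · 1#                                ≡⟨ N·1≡0 ⟩
    0#                                    ≡⟨ -‿inverseʳ 1# ⟨
    1# + - 1#                             ∎)
    where
    split : ∀ x → at0 1# 0# x + at0 0# 1# x ≡ 1#
    split x with x ≟ 0#
    ... | yes _ = +-identityʳ 1#
    ... | no _  = +-identityˡ 1#

  ∏ᴷ-nonzero : ∀ f → (∀ x → f x ≢ 0#) → ∏ᴷ f ≢ 0#
  ∏ᴷ-nonzero f f≢0 = go (f ∘ from) (f≢0 ∘ from)
    where
    go : ∀ {n} (t : Vector Carrier n) → (∀ i → t i ≢ 0#) → ∏.sum t ≢ 0#
    go {zero}  t t≢0 = 1≢0
    go {suc n} t t≢0 = *-nonzero (t≢0 zero) (go (t ∘ suc) (t≢0 ∘ suc))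

  -- Multiplication by `g` permutes `K*`, so the product `P` of its elements absorbs `g^(N-1)`. An
  -- additional factor `g` at the point `0#` completes this to `g^N`, which avoids the exponent
  -- `N - 1`.
  fermat : ∀ x → x ^ˢ N ≡ x
  fermat g with g ≟ 0#
  ... | yes refl = zero^ N (to 0#)
    where
    zero^ : ∀ n → Fin n → 0# ^ˢ n ≡ 0#
    zero^ (suc n) _ = zeroˡ _
  ... | no g≢0 = sym (*-cancel-nonzero P≢0 (begin
    P * g                                           ≡⟨ cong₂ _*_ (∏ᴷ-scale g≢0 unit) (sym (∏ᴷ-at0 g)) ⟩
    ∏ᴷ (λ x → unit (g * x)) * ∏ᴷ (at0 g 1#)         ≡⟨ ∏.∑-distrib-+ (λ i → unit (g * from i)) (at0 g 1# ∘ from) ⟨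
    ∏ᴷ (λ x → unit (g * x) * at0 g 1# x)            ≡⟨ ∏.sum-cong-≗ (scaled ∘ from) ⟩
    ∏ᴷ (λ x → unit x * g)                           ≡⟨ ∏.∑-distrib-+ (unit ∘ from) (λ _ → g) ⟩
    P * ∏ᴷ (λ _ → g)                                ≡⟨ cong (P *_) (∏.sum-replicate N) ⟩
    P * g ^ˢ N                                       ∎))
    where
    unit : Carrier → Carrier
    unit x = at0 1# x x
    unit≢0 : ∀ x → unit x ≢ 0#
    unit≢0 x with x ≟ 0#
    ... | yes _  = 1≢0
    ... | no x≢0 = x≢0
    P = ∏ᴷ unit
    P≢0 : P ≢ 0#
    P≢0 = ∏ᴷ-nonzero unit unit≢0
    scaled : ∀ x → unit (g * x) * at0 g 1# x ≡ unit x * g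
    scaled x with x ≟ 0#
    ... | yes refl = cong (_* g) (trans (cong unit (zeroʳ g)) (at0-zero 1# 0#))
    ... | no x≢0   = trans (*-identityʳ _) (trans (at0-nonzero 1# (g * x) (*-nonzero g≢0 x≢0)) (*-comm g x))

  -- Vec Carrier d lists the lower coefficients of a monic polynomial of degree d.
  eval : ∀ {d} → Vec Carrier d → Carrier → Carrier
  eval []       x = 1#
  eval (a ∷ as) x = a + x * eval as x

  -- The sum stays monic because `s` has degree one less than `p`.
  addScaled : ∀ {d} (p : Vec Carrier (suc d)) (s : Vec Carrier d) r →
              Σ (Vec Carrier (suc d)) λ t → ∀ x → eval t x ≡ eval p x + r * eval s x
  addScaled (a ∷ []) [] r = (a + r) ∷ [] ,
    λ x → solve 3 (λ a r x → a :+ r :+ x :* con 1 := a :+ x :* con 1 :+ r :* con 1) refl a r x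
  addScaled (a ∷ as@(_ ∷ _)) (b ∷ bs) r = let (t , eq) = addScaled as bs r in (a + r * b) ∷ t ,
    λ x → trans (cong (λ y → a + r * b + x * y) (eq x))
      (solve 6 (λ a r b x y z → a :+ r :* b :+ x :* (y :+ r :* z) := a :+ x :* y :+ r :* (b :+ x :* z))
        refl a r b x (eval as x) (eval bs x))

  -- The quotient of p(x) - p(r) by x - r, with the equation arranged so that no subtraction occurs.
  quotient : ∀ {d} (p : Vec Carrier (suc d)) r →
             Σ (Vec Carrier d) λ s → ∀ x → eval p x + r * eval s x ≡ eval p r + x * eval s x
  quotient (a ∷ []) r = [] ,
    λ x → solve 3 (λ a r x → a :+ x :* con 1 :+ r :* con 1 := a :+ r :* con 1 :+ x :* con 1) refl a r x
  quotient (a ∷ as@(_ ∷ _)) r =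
    let (s , eq) = quotient as r
        (t , eq′) = addScaled as s r
    in t , λ x → begin
      a + x * eval as x + r * eval t x
        ≡⟨ cong (λ y → a + x * eval as x + r * y) (trans (eq′ x) (eq x)) ⟩
      a + x * eval as x + r * (eval as r + x * eval s x)
        ≡⟨ solve 6 (λ a x r y z w → a :+ x :* y :+ r :* (z :+ x :* w) := a :+ r :* z :+ x :* (y :+ r :* w))
             refl a x r (eval as x) (eval as r) (eval s x) ⟩
      a + r * eval as r + x * (eval as x + r * eval s x)
        ≡⟨ cong (λ y → a + r * eval as r + x * y) (eq′ x) ⟨
      a + r * eval as r + x * eval t x ∎

  -- Induction on the degree: the other points differ from `ρ zero`, so they are roots of the
  -- quotient by `x - ρ zero`.
  root-bound : ∀ {d} (p : Vec Carrier d) (ρ : Fin (suc d) → Carrier) → (∀ {i j} → ρ i ≡ ρ j → i ≡ j) →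
               ¬ (∀ i → eval p (ρ i) ≡ 0#)
  root-bound []         ρ inj roots = 1≢0 (roots zero)
  root-bound p@(_ ∷ _) ρ inj roots = let (s , eq) = quotient p (ρ zero) in
    root-bound s (ρ ∘ suc) (Fin.suc-injective ∘ inj) λ i →
      *-cancelʳ-or (ρ zero) (ρ (suc i)) _
        (+-cancelˡ 0# _ _ (begin
          0# + ρ zero * eval s (ρ (suc i))                     ≡⟨ cong (_+ (ρ zero * eval s (ρ (suc i)))) (roots (suc i)) ⟨
          eval p (ρ (suc i)) + ρ zero * eval s (ρ (suc i))     ≡⟨ eq (ρ (suc i)) ⟩
          eval p (ρ zero) + ρ (suc i) * eval s (ρ (suc i))     ≡⟨ cong (_+ (ρ (suc i) * eval s (ρ (suc i)))) (roots zero) ⟩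
          0# + ρ (suc i) * eval s (ρ (suc i))                  ∎))
        (λ eq → Fin.0≢1+n (inj eq))

  from-injective : ∀ {i j} → from i ≡ from j → i ≡ j
  from-injective {i} {j} eq = trans (sym (strictlyInverseˡ i)) (trans (cong to eq) (strictlyInverseˡ j))

  -- The degree of x^(2 + d) - x is too small for it to vanish on all of K.
  ^≢id : ∀ d → 2 ℕ.+ d < N → ¬ (∀ x → x ^ˢ (2 ℕ.+ d) ≡ x)
  ^≢id d d<N eq = root-bound (0# ∷ - 1# ∷ replicate d 0#) (λ i → from (inject≤ i d<N))
    (Fin.inject≤-injective d<N d<N _ _ ∘ from-injective) (λ i → vanish (from (inject≤ i d<N)))
    where
    eval-x^ : ∀ d x → eval (replicate d 0#) x ≡ x ^ˢ d
    eval-x^ zero x = refl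
    eval-x^ (suc d) x = trans (+-identityˡ _) (cong (x *_) (eval-x^ d x))
    vanish : ∀ x → eval (0# ∷ - 1# ∷ replicate d 0#) x ≡ 0#
    vanish x = begin
      0# + x * (- 1# + x * eval (replicate d 0#) x)   ≡⟨ +-identityˡ _ ⟩
      x * (- 1# + x * eval (replicate d 0#) x)        ≡⟨ cong (λ y → x * (- 1# + x * y)) (eval-x^ d x) ⟩
      x * (- 1# + x ^ˢ suc d)                          ≡⟨ distribˡ x _ _ ⟩
      x * - 1# + x ^ˢ (2 ℕ.+ d)                        ≡⟨ cong (x * - 1# +_) (trans (eq x) (sym (*-identityʳ x))) ⟩
      x * - 1# + x * 1#                               ≡⟨ distribˡ x _ _ ⟨
      x * (- 1# + 1#)                                 ≡⟨ cong (x *_) (-‿inverseˡ 1#) ⟩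
      x * 0#                                          ≡⟨ zeroʳ x ⟩
      0#                                              ∎

  -- Cancelling `x ^ˢ A`, one factor fewer than possible, leaves `x ^ˢ (2 + d) ≡ x`, an identity
  -- that also holds at `0#` and that `^≢id` excludes.
  ^-distinct : ∀ {A B} → A < B → suc B < N → ¬ (∀ x → x ^ˢ suc A ≡ x ^ˢ suc B)
  ^-distinct {A} {B} A<B B<N eq with ℕ.m≤n⇒∃[o]m+o≡n A<B
  ... | d , refl = ^≢id d (ℕ.≤-trans (s≤s (s≤s (s≤s (ℕ.m≤n+m d A)))) B<N) identity
    where
    identity : ∀ x → x ^ˢ (2 ℕ.+ d) ≡ x
    identity x with x ≟ 0#
    ... | yes refl = zeroˡ _
    ... | no x≢0 = *-cancel-nonzero (^-nonzero A x≢0) (begin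
      x ^ˢ A * x ^ˢ (2 ℕ.+ d)       ≡⟨ ^-homo-* x A (2 ℕ.+ d) ⟨
      x ^ˢ (A ℕ.+ (2 ℕ.+ d))       ≡⟨ cong (x ^ˢ_) (trans (ℕ.+-suc A (suc d)) (cong suc (ℕ.+-suc A d))) ⟩
      x ^ˢ suc (suc A ℕ.+ d)       ≡⟨ eq x ⟨
      x ^ˢ suc A                   ≡⟨ *-comm x (x ^ˢ A) ⟩
      x ^ˢ A * x                   ∎)

  -- The sum of x^(E - F) over x ≠ 0: the shift of both exponents by one removes the term at x = 0.
  powerSum : ℕ → ℕ → Carrier
  powerSum E F = ∑ᴷ (λ x → x ^ˢ suc E * inv x ^ˢ suc F)

  powerSum-diag : ∀ E → powerSum E E ≡ - 1#
  powerSum-diag E = trans (∑ᴷ-cong term) ∑ᴷ-nonzero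
    where
    term : ∀ x → x ^ˢ suc E * inv x ^ˢ suc E ≡ at0 0# 1# x
    term x = go (x ≟ 0#)
      where
      go : Dec (x ≡ 0#) → x ^ˢ suc E * inv x ^ˢ suc E ≡ at0 0# 1# x
      go (yes refl) = trans (trans (cong (_* (inv 0# ^ˢ suc E)) (zeroˡ (0# ^ˢ E))) (zeroˡ (inv 0# ^ˢ suc E))) (sym (at0-zero 0# 1#))
      go (no x≢0)   = trans (sym (^-distrib-* x (inv x) (suc E)))
        (trans (cong (_^ˢ suc E) (*-inv x≢0)) (trans (1^n≡1 (suc E)) (sym (at0-nonzero 0# 1# x≢0))))

  -- The substitution of `g * x` for `x` multiplies the sum by `g^(E - F)`. If the sum were nonzero,
  -- all `g` would satisfy `g ^ˢ suc E ≡ g ^ˢ suc F`, against `^-distinct`.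
  powerSum-offdiag : ∀ {E F} → suc E < N → suc F < N → E ≢ F → powerSum E F ≡ 0#
  powerSum-offdiag {E} {F} E<N F<N E≢F with powerSum E F ≟ 0#
  ... | yes p = p
  ... | no S≢0 = ⊥-elim (clash (ℕ.<-cmp E F))
    where
    S = powerSum E F
    term : Carrier → Carrier
    term x = x ^ˢ suc E * inv x ^ˢ suc F
    agree : ∀ g → g ^ˢ suc E ≡ g ^ˢ suc F
    agree g with g ≟ 0#
    ... | yes refl = trans (zeroˡ _) (sym (zeroˡ _))
    ... | no g≢0 = *-cancel-nonzero S≢0 (begin
      S * g ^ˢ suc E                                     ≡⟨ *-comm S _ ⟩
      g ^ˢ suc E * S                                     ≡⟨ ∑ᴷ-*ˡ (g ^ˢ suc E) term ⟨
      ∑ᴷ (λ x → g ^ˢ suc E * term x)  ≡⟨ ∑ᴷ-cong shifted ⟩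
      ∑ᴷ (λ x → g ^ˢ suc F * term (g * x))  ≡⟨ ∑ᴷ-*ˡ (g ^ˢ suc F) (term ∘ (g *_)) ⟩
      g ^ˢ suc F * ∑ᴷ (λ x → term (g * x))  ≡⟨ cong (g ^ˢ suc F *_) (∑ᴷ-scale g≢0 term) ⟨
      g ^ˢ suc F * S                                     ≡⟨ *-comm _ S ⟩
      S * g ^ˢ suc F                                     ∎)
      where
      shifted : ∀ x → g ^ˢ suc E * term x ≡ g ^ˢ suc F * term (g * x)
      shifted x = sym (begin
        g ^ˢ suc F * ((g * x) ^ˢ suc E * inv (g * x) ^ˢ suc F)
          ≡⟨ cong₂ (λ u v → g ^ˢ suc F * (u * v)) (^-distrib-* g x (suc E))
               (trans (cong (_^ˢ suc F) (inv-* x g≢0)) (^-distrib-* (inv g) (inv x) (suc F))) ⟩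
        g ^ˢ suc F * (g ^ˢ suc E * x ^ˢ suc E * (inv g ^ˢ suc F * inv x ^ˢ suc F))
          ≡⟨ solve 5 (λ a b c d e → a :* (b :* c :* (d :* e)) := a :* d :* (b :* (c :* e))) refl
               (g ^ˢ suc F) (g ^ˢ suc E) (x ^ˢ suc E) (inv g ^ˢ suc F) (inv x ^ˢ suc F) ⟩
        g ^ˢ suc F * inv g ^ˢ suc F * (g ^ˢ suc E * (x ^ˢ suc E * inv x ^ˢ suc F))
          ≡⟨ cong (_* (g ^ˢ suc E * (x ^ˢ suc E * inv x ^ˢ suc F)))
               (trans (sym (^-distrib-* g (inv g) (suc F))) (trans (cong (_^ˢ suc F) (*-inv g≢0)) (1^n≡1 (suc F)))) ⟩
        1# * (g ^ˢ suc E * (x ^ˢ suc E * inv x ^ˢ suc F))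
          ≡⟨ *-identityˡ _ ⟩
        g ^ˢ suc E * (x ^ˢ suc E * inv x ^ˢ suc F) ∎)
    clash : Tri (E < F) (E ≡ F) (F < E) → ⊥
    clash (tri< E<F _ _) = ^-distinct E<F F<N agree
    clash (tri≈ _ E≡F _) = E≢F E≡F
    clash (tri> _ _ F<E) = ^-distinct F<E E<N (sym ∘ agree)

-- Sums over words, and the enumeration of words with two letters.

module WordSums {N : ℕ} (K : FiniteField N) where
  open FiniteField K hiding (_-_)
  open FieldTheory K
  open CommutativeRing ring using
    (+-identityˡ; +-identityʳ; *-identityˡ; zeroˡ; zeroʳ; distribˡ; distribʳ; commutativeSemiring; semiring)
  open import Algebra.Properties.CommutativeSemiring.Exp commutativeSemiring
    using (^-homo-*) renaming (_^_ to _^ˢ_)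
  open import Algebra.Properties.Semiring.Mult semiring
    using (×-homo-+) renaming (_×_ to _·_)
  open import Algebra.Solver.Ring.NaturalCoefficients.Default commutativeSemiring
    using (solve; _:+_; _:=_)
  open ≡-Reasoning

  sumUpTo-cong : ∀ n {f g} → (∀ i → i < n → f i ≡ g i) → sumUpTo n f ≡ sumUpTo n g
  sumUpTo-cong zero    eq = refl
  sumUpTo-cong (suc n) eq = cong₂ _+_ (sumUpTo-cong n (λ i i<n → eq i (ℕ.m<n⇒m<1+n i<n))) (eq n (ℕ.n<1+n n))

  sumUpTo-zero : ∀ n {f} → (∀ i → i < n → f i ≡ 0#) → sumUpTo n f ≡ 0#
  sumUpTo-zero zero    eq = refl
  sumUpTo-zero (suc n) eq =
    trans (cong₂ _+_ (sumUpTo-zero n (λ i i<n → eq i (ℕ.m<n⇒m<1+n i<n))) (eq n (ℕ.n<1+n n))) (+-identityʳ 0#)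

  sumUpTo-+ : ∀ n f g → sumUpTo n (λ i → f i + g i) ≡ sumUpTo n f + sumUpTo n g
  sumUpTo-+ zero    f g = sym (+-identityʳ 0#)
  sumUpTo-+ (suc n) f g = trans (cong (_+ (f n + g n)) (sumUpTo-+ n f g))
    (solve 4 (λ a b c d → a :+ b :+ (c :+ d) := a :+ c :+ (b :+ d)) refl (sumUpTo n f) (sumUpTo n g) (f n) (g n))

  sumUpTo-*ˡ : ∀ n c f → c * sumUpTo n f ≡ sumUpTo n (λ i → c * f i)
  sumUpTo-*ˡ zero    c f = zeroʳ c
  sumUpTo-*ˡ (suc n) c f = trans (distribˡ c _ _) (cong (_+ c * f n) (sumUpTo-*ˡ n c f))

  sumUpTo-*ʳ : ∀ n c f → sumUpTo n f * c ≡ sumUpTo n (λ i → f i * c)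
  sumUpTo-*ʳ zero    c f = zeroˡ c
  sumUpTo-*ʳ (suc n) c f = trans (distribʳ c _ _) (cong (_+ f n * c) (sumUpTo-*ʳ n c f))

  -- Both sides sum `f 0, ..., f n`. This subtraction-free form serves the cyclic shift of the
  -- conjugates in a trace and the geometric sum.
  sumUpTo-shift : ∀ n f → sumUpTo n (f ∘ suc) + f 0 ≡ sumUpTo n f + f n
  sumUpTo-shift zero    f = refl
  sumUpTo-shift (suc n) f = begin
    sumUpTo n (f ∘ suc) + f (suc n) + f 0     ≡⟨ solve 3 (λ a b c → a :+ b :+ c := a :+ c :+ b) refl (sumUpTo n (f ∘ suc)) (f (suc n)) (f 0) ⟩
    sumUpTo n (f ∘ suc) + f 0 + f (suc n)     ≡⟨ cong (_+ f (suc n)) (sumUpTo-shift n f) ⟩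
    sumUpTo n f + f n + f (suc n)             ∎

  ∑ᴷ-sumUpTo : ∀ n (f : Carrier → ℕ → Carrier) →
               ∑ᴷ (λ x → sumUpTo n (f x)) ≡ sumUpTo n (λ i → ∑ᴷ (λ x → f x i))
  ∑ᴷ-sumUpTo zero    f = ∑ᴷ-zero
  ∑ᴷ-sumUpTo (suc n) f = trans (∑ᴷ-distrib-+ (λ x → sumUpTo n (f x)) (λ x → f x n))
    (cong (_+ ∑ᴷ (λ x → f x n)) (∑ᴷ-sumUpTo n f))

  δ : ℕ → ℕ → Carrier
  δ i α = if does (i ℕ.≟ α) then 1# else 0#

  δ-≡ : ∀ α → δ α α ≡ 1#
  δ-≡ α = cong (if_then 1# else 0#) (dec-true (α ℕ.≟ α) refl)

  δ-≢ : ∀ {i α} → i ≢ α → δ i α ≡ 0#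
  δ-≢ {i} {α} i≢α = cong (if_then 1# else 0#) (dec-false (i ℕ.≟ α) i≢α)

  sumUpTo-δ : ∀ n {α} c → α < n → sumUpTo n (λ i → δ i α * c) ≡ c
  sumUpTo-δ (suc n) {α} c α<1+n with n ℕ.≟ α
  ... | yes refl = trans (cong₂ _+_
          (sumUpTo-zero n (λ i i<n → trans (cong (_* c) (δ-≢ (ℕ.<⇒≢ i<n))) (zeroˡ c)))
          (trans (cong (_* c) (δ-≡ n)) (*-identityˡ c))) (+-identityˡ c)
  ... | no n≢α = trans (cong₂ _+_ (sumUpTo-δ n c (ℕ.≤∧≢⇒< (ℕ.≤-pred α<1+n) (n≢α ∘ sym)))
          (trans (cong (_* c) (δ-≢ n≢α)) (zeroˡ c))) (+-identityʳ c)

  sumWords : ℕ → ℕ → (List ℕ → Carrier) → Carrier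
  sumWords n zero    φ = φ []
  sumWords n (suc j) φ = sumUpTo n (λ i → sumWords n j (λ w → φ (i ∷ w)))

  sumWords-cong : ∀ n j {φ ψ} → (∀ w → length w ≡ j → All (_< n) w → φ w ≡ ψ w) →
                  sumWords n j φ ≡ sumWords n j ψ
  sumWords-cong n zero    eq = eq [] refl []
  sumWords-cong n (suc j) eq = sumUpTo-cong n (λ i i<n →
    sumWords-cong n j (λ w l a → eq (i ∷ w) (cong suc l) (i<n ∷ a)))

  sumWords-zero : ∀ n j {φ} → (∀ w → length w ≡ j → φ w ≡ 0#) → sumWords n j φ ≡ 0#
  sumWords-zero n zero    eq = eq [] refl
  sumWords-zero n (suc j) eq = sumUpTo-zero n (λ i _ → sumWords-zero n j (λ w l → eq (i ∷ w) (cong suc l)))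

  sumWords-+ : ∀ n j φ ψ → sumWords n j (λ w → φ w + ψ w) ≡ sumWords n j φ + sumWords n j ψ
  sumWords-+ n zero    φ ψ = refl
  sumWords-+ n (suc j) φ ψ =
    trans (sumUpTo-cong n (λ i _ → sumWords-+ n j (φ ∘ (i ∷_)) (ψ ∘ (i ∷_)))) (sumUpTo-+ n _ _)

  sumWords-*ˡ : ∀ n j c φ → c * sumWords n j φ ≡ sumWords n j (λ w → c * φ w)
  sumWords-*ˡ n zero    c φ = refl
  sumWords-*ˡ n (suc j) c φ = trans (sumUpTo-*ˡ n c _) (sumUpTo-cong n (λ i _ → sumWords-*ˡ n j c (φ ∘ (i ∷_))))

  sumWords-*ʳ : ∀ n j c φ → sumWords n j φ * c ≡ sumWords n j (λ w → φ w * c)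
  sumWords-*ʳ n zero    c φ = refl
  sumWords-*ʳ n (suc j) c φ = trans (sumUpTo-*ʳ n c _) (sumUpTo-cong n (λ i _ → sumWords-*ʳ n j c (φ ∘ (i ∷_))))

  sumWords-* : ∀ n j φ ψ → sumWords n j φ * sumWords n j ψ ≡ sumWords n j (λ w → sumWords n j (λ w′ → φ w * ψ w′))
  sumWords-* n j φ ψ = trans (sumWords-*ʳ n j _ φ) (sumWords-cong n j (λ w _ _ → sumWords-*ˡ n j (φ w) ψ))

  ∑ᴷ-sumWords : ∀ n j (f : Carrier → List ℕ → Carrier) →
                ∑ᴷ (λ x → sumWords n j (f x)) ≡ sumWords n j (λ w → ∑ᴷ (λ x → f x w))
  ∑ᴷ-sumWords n zero    f = refl
  ∑ᴷ-sumWords n (suc j) f = trans (∑ᴷ-sumUpTo n (λ x i → sumWords n j (λ w → f x (i ∷ w))))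
    (sumUpTo-cong n (λ i _ → ∑ᴷ-sumWords n j (λ x w → f x (i ∷ w))))

  power-expansion : ∀ q n j x → sumUpTo n (λ i → x ^ˢ (q ℕ.^ i)) ^ˢ j ≡ sumWords n j (λ w → x ^ˢ val q w)
  power-expansion q n zero    x = refl
  power-expansion q n (suc j) x = begin
    sumUpTo n f * sumUpTo n f ^ˢ j
      ≡⟨ cong (sumUpTo n f *_) (power-expansion q n j x) ⟩
    sumUpTo n f * sumWords n j (λ w → x ^ˢ val q w)
      ≡⟨ sumUpTo-*ʳ n _ f ⟩
    sumUpTo n (λ i → f i * sumWords n j (λ w → x ^ˢ val q w))
      ≡⟨ sumUpTo-cong n (λ i _ → trans (sumWords-*ˡ n j (f i) _)
           (sumWords-cong n j (λ w _ _ → sym (^-homo-* x (q ℕ.^ i) (val q w))))) ⟩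
    sumUpTo n (λ i → sumWords n j (λ w → x ^ˢ val q (i ∷ w))) ∎
    where
    f : ℕ → Carrier
    f i = x ^ˢ (q ℕ.^ i)

  -- Indicator of the words consisting of u letters α and v letters β.
  module _ (α β : ℕ) where
    base : ℕ → ℕ → Carrier
    base zero    zero    = 1#
    base zero    (suc v) = 0#
    base (suc u) v       = 0#

    ind indˡ indʳ : ℕ → ℕ → List ℕ → Carrier
    ind u v []      = base u v
    ind u v (i ∷ w) = δ i α * indˡ u v w + δ i β * indʳ u v w
    indˡ zero    v w = 0#
    indˡ (suc u) v w = ind u v w
    indʳ u zero    w = 0#
    indʳ u (suc v) w = ind u v w

  module _ {α β : ℕ} (α≢β : α ≢ β) where
    ind-α : ∀ u v w → ind α β u v (α ∷ w) ≡ indˡ α β u v w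
    ind-α u v w = trans (cong₂ _+_
      (trans (cong (_* indˡ α β u v w) (δ-≡ α)) (*-identityˡ _))
      (trans (cong (_* indʳ α β u v w) (δ-≢ α≢β)) (zeroˡ _))) (+-identityʳ _)

    ind-β : ∀ u v w → ind α β u v (β ∷ w) ≡ indʳ α β u v w
    ind-β u v w = trans (cong₂ _+_
      (trans (cong (_* indˡ α β u v w) (δ-≢ (α≢β ∘ sym))) (zeroˡ _))
      (trans (cong (_* indʳ α β u v w) (δ-≡ β)) (*-identityˡ _))) (+-identityˡ _)

    ind-other : ∀ {i} u v w → i ≢ α → i ≢ β → ind α β u v (i ∷ w) ≡ 0#
    ind-other u v w i≢α i≢β = trans (cong₂ _+_
      (trans (cong (_* indˡ α β u v w) (δ-≢ i≢α)) (zeroˡ _))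
      (trans (cong (_* indʳ α β u v w) (δ-≢ i≢β)) (zeroˡ _))) (+-identityˡ _)

    -- The two counts exhaust the length, so no third letter occurs.
    ind-one : ∀ u v w → count α w ≡ u → count β w ≡ v → length w ≤ u ℕ.+ v → ind α β u v w ≡ 1#
    ind-one u v [] refl refl _ = refl
    ind-one u v (i ∷ w) cα cβ l with i ℕ.≟ α
    ... | yes refl rewrite sym cα | sym cβ | count-≡ i w | count-≢ w α≢β =
      trans (ind-α (suc (count i w)) (count β w) w) (ind-one _ _ w refl refl (ℕ.≤-pred l))
    ... | no i≢α with i ℕ.≟ β
    ...   | yes refl rewrite sym cα | sym cβ | count-≡ i w | count-≢ w i≢α =
      trans (ind-β (count α w) (suc (count i w)) w)
        (ind-one _ _ w refl refl (ℕ.≤-pred (ℕ.≤-trans l (ℕ.≤-reflexive (ℕ.+-suc (count α w) (count i w))))))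
    ...   | no i≢β rewrite sym cα | sym cβ | count-≢ w i≢α | count-≢ w i≢β =
      ⊥-elim (ℕ.<-irrefl refl (ℕ.≤-trans l (count₂≤length α≢β w)))

    -- Rearranging letters changes neither length nor value, so a nonvanishing indicator determines
    -- both.
    ind-support : ∀ q u v w → ind α β u v w ≡ 0# ⊎
                  (length w ≡ u ℕ.+ v × val q w ≡ u ℕ.* q ℕ.^ α ℕ.+ v ℕ.* q ℕ.^ β)
    ind-support q zero    zero    [] = inj₂ (refl , refl)
    ind-support q zero    (suc v) [] = inj₁ refl
    ind-support q (suc u) v       [] = inj₁ refl
    ind-support q u v (i ∷ w) with i ℕ.≟ α
    ind-support q zero v (i ∷ w) | yes refl = inj₁ (ind-α zero v w)
    ind-support q (suc u) v (i ∷ w) | yes refl with ind-support q u v w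
    ... | inj₁ z = inj₁ (trans (ind-α (suc u) v w) z)
    ... | inj₂ (l , e) = inj₂ (cong suc l ,
      trans (cong (q ℕ.^ α ℕ.+_) e) (sym (ℕ.+-assoc (q ℕ.^ α) (u ℕ.* q ℕ.^ α) _)))
    ind-support q u v (i ∷ w) | no i≢α with i ℕ.≟ β
    ind-support q u zero (i ∷ w) | no i≢α | yes refl = inj₁ (ind-β u zero w)
    ind-support q u (suc v) (i ∷ w) | no i≢α | yes refl with ind-support q u v w
    ... | inj₁ z = inj₁ (trans (ind-β u (suc v) w) z)
    ... | inj₂ (l , e) = inj₂ (trans (cong suc l) (sym (ℕ.+-suc u v)) , (begin
      q ℕ.^ β ℕ.+ val q w                                        ≡⟨ cong (q ℕ.^ β ℕ.+_) e ⟩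
      q ℕ.^ β ℕ.+ (u ℕ.* q ℕ.^ α ℕ.+ v ℕ.* q ℕ.^ β)              ≡⟨ ℕ.+-assoc (q ℕ.^ β) _ _ ⟨
      q ℕ.^ β ℕ.+ u ℕ.* q ℕ.^ α ℕ.+ v ℕ.* q ℕ.^ β                ≡⟨ cong (ℕ._+ v ℕ.* q ℕ.^ β) (ℕ.+-comm (q ℕ.^ β) _) ⟩
      u ℕ.* q ℕ.^ α ℕ.+ q ℕ.^ β ℕ.+ v ℕ.* q ℕ.^ β                ≡⟨ ℕ.+-assoc (u ℕ.* q ℕ.^ α) _ _ ⟩
      u ℕ.* q ℕ.^ α ℕ.+ suc v ℕ.* q ℕ.^ β                        ∎))
    ind-support q u v (i ∷ w) | no i≢α | no i≢β = inj₁ (ind-other u v w i≢α i≢β)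

    module _ {n} (α<n : α < n) (β<n : β < n) where
      sumWords-ind-step : ∀ j u v → sumWords n (suc j) (ind α β u v) ≡
                          sumWords n j (indˡ α β u v) + sumWords n j (indʳ α β u v)
      sumWords-ind-step j u v = begin
        sumUpTo n (λ i → sumWords n j (λ w → δ i α * indˡ α β u v w + δ i β * indʳ α β u v w))
          ≡⟨ sumUpTo-cong n (λ i _ → trans (sumWords-+ n j _ _)
               (cong₂ _+_ (sym (sumWords-*ˡ n j (δ i α) _)) (sym (sumWords-*ˡ n j (δ i β) _)))) ⟩
        sumUpTo n (λ i → δ i α * sumWords n j (indˡ α β u v) + δ i β * sumWords n j (indʳ α β u v))
          ≡⟨ sumUpTo-+ n _ _ ⟩
        sumUpTo n (λ i → δ i α * sumWords n j (indˡ α β u v)) + sumUpTo n (λ i → δ i β * sumWords n j (indʳ α β u v))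
          ≡⟨ cong₂ _+_ (sumUpTo-δ n _ α<n) (sumUpTo-δ n _ β<n) ⟩
        sumWords n j (indˡ α β u v) + sumWords n j (indʳ α β u v) ∎

      -- Splitting off the first letter turns the count of such words into Pascal's rule.
      sumWords-ind : ∀ j u v → j ≡ u ℕ.+ v → sumWords n j (ind α β u v) ≡ (j C u) · 1#
      sumWords-ind zero    zero    zero    refl = sym (+-identityʳ 1#)
      sumWords-ind (suc j) zero    (suc v) refl = begin
        sumWords n (suc j) (ind α β 0 (suc v))                              ≡⟨ sumWords-ind-step j 0 (suc v) ⟩
        sumWords n j (λ _ → 0#) + sumWords n j (ind α β 0 v)                ≡⟨ cong₂ _+_ (sumWords-zero n j (λ _ _ → refl)) (sumWords-ind j 0 v refl) ⟩
        0# + 1 · 1#                                                         ≡⟨ +-identityˡ _ ⟩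
        1 · 1#                                                              ∎
      sumWords-ind (suc j) (suc u) zero    eq = begin
        sumWords n (suc j) (ind α β (suc u) 0)                              ≡⟨ sumWords-ind-step j (suc u) 0 ⟩
        sumWords n j (ind α β u 0) + sumWords n j (λ _ → 0#)                ≡⟨ cong₂ _+_ (sumWords-ind j u 0 (ℕ.suc-injective eq)) (sumWords-zero n j (λ _ _ → refl)) ⟩
        (j C u) · 1# + 0#                                                   ≡⟨ +-identityʳ _ ⟩
        (j C u) · 1#                                                        ≡⟨ cong (_· 1#) (ℕ.+-identityʳ (j C u)) ⟨
        -- Here `j = u`, and the vanishing `j C suc u` is inserted so that Pascal's rule applies in
        -- this boundary case too.
        (j C u ℕ.+ 0) · 1#                                                  ≡⟨ cong (λ c → (j C u ℕ.+ c) · 1#) (k>n⇒nCk≡0 (s≤s (ℕ.≤-reflexive (trans (ℕ.suc-injective eq) (ℕ.+-identityʳ u))))) ⟨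
        (j C u ℕ.+ j C suc u) · 1#                                          ≡⟨ cong (_· 1#) (nCk+nC[k+1]≡[n+1]C[k+1] j u) ⟩
        (suc j C suc u) · 1#                                                ∎
      sumWords-ind (suc j) (suc u) (suc v) eq = begin
        sumWords n (suc j) (ind α β (suc u) (suc v))                              ≡⟨ sumWords-ind-step j (suc u) (suc v) ⟩
        sumWords n j (ind α β u (suc v)) + sumWords n j (ind α β (suc u) v)       ≡⟨ cong₂ _+_ (sumWords-ind j u (suc v) (ℕ.suc-injective eq))
                                                                                        (sumWords-ind j (suc u) v (trans (ℕ.suc-injective eq) (ℕ.+-suc u v))) ⟩
        (j C u) · 1# + (j C suc u) · 1#                                           ≡⟨ ×-homo-+ 1# (j C u) (j C suc u) ⟨
        (j C u ℕ.+ j C suc u) · 1#                                                ≡⟨ cong (_· 1#) (nCk+nC[k+1]≡[n+1]C[k+1] j u) ⟩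
        (suc j C suc u) · 1#                                                      ∎

      sumWords-ind-zero : ∀ j u v → j ≢ u ℕ.+ v → sumWords n j (ind α β u v) ≡ 0#
      sumWords-ind-zero j u v j≢ = sumWords-zero n j λ w l →
        -- The base `0` is a dummy: only the length is read off, and it does not involve the base.
        [ (λ z → z) , (λ (l′ , _) → ⊥-elim (j≢ (trans (sym l) l′))) ]′ (ind-support 0 u v w)

-- Characteristic p, Frobenius and the trace.

module Trace (q n p k : ℕ) (pr : Prime p) (q≡p^k : q ≡ p ℕ.^ k) (K : FiniteField (q ℕ.^ n)) where
  open FiniteField K hiding (_-_)
  open FieldTheory K
  open WordSums K
  open CommutativeRing ring using
    (+-comm; +-identityˡ; +-identityʳ; *-identityˡ; *-identityʳ; zeroˡ; zeroʳ; commutativeSemiring; semiring; +-commutativeMonoid)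
  open import Algebra.Properties.Ring (CommutativeRing.ring ring) using (+-cancelˡ; +-cancelʳ)
  open import Algebra.Properties.CommutativeSemiring.Exp commutativeSemiring
    using (^-homo-*; ^-assocʳ; ^-distrib-*) renaming (_^_ to _^ˢ_)
  open import Algebra.Properties.Semiring.Mult semiring
    using (×1-homo-*; ×-assoc-*; ×-homo-+) renaming (_×_ to _·_)
  import Algebra.Properties.CommutativeMonoid.Sum +-commutativeMonoid as ∑
  import Algebra.Properties.CommutativeSemiring.Binomial commutativeSemiring as Binomial
  open import Algebra.Solver.Ring.NaturalCoefficients.Default commutativeSemiring
    using (solve; _:*_; _:=_)
  open ≡-Reasoning

  ^-·1 : ∀ c m → (c ℕ.^ m) · 1# ≡ (c · 1#) ^ˢ m
  ^-·1 c zero    = +-identityʳ 1#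
  ^-·1 c (suc m) = trans (×1-homo-* c (c ℕ.^ m)) (cong ((c · 1#) *_) (^-·1 c m))

  -- The power `(p · 1#)^(kn)` is `N · 1# ≡ 0#`, and a field has no nonzero nilpotent element.
  p·1≡0 : p · 1# ≡ 0#
  p·1≡0 with (p · 1#) ≟ 0#
  ... | yes eq = eq
  ... | no ≢0 = ⊥-elim (^-nonzero (k ℕ.* n) ≢0 (begin
    (p · 1#) ^ˢ (k ℕ.* n)        ≡⟨ ^-·1 p (k ℕ.* n) ⟨
    (p ℕ.^ (k ℕ.* n)) · 1#      ≡⟨ cong (_· 1#) (trans (sym (ℕ.^-*-assoc p k n)) (cong (ℕ._^ n) (sym q≡p^k))) ⟩
    (q ℕ.^ n) · 1#              ≡⟨ N·1≡0 ⟩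
    0#                          ∎))

  ∣⇒·1≡0 : ∀ {m} → p ∣ m → m · 1# ≡ 0#
  ∣⇒·1≡0 (divides c refl) = trans (×1-homo-* c p) (trans (cong ((c · 1#) *_) p·1≡0) (zeroʳ _))

  ∣⇒·≡0 : ∀ {m} → p ∣ m → ∀ x → m · x ≡ 0#
  ∣⇒·≡0 {m} d x = begin
    m · x            ≡⟨ cong (m ·_) (*-identityˡ x) ⟨
    m · (1# * x)     ≡⟨ ×-assoc-* m 1# x ⟨
    (m · 1#) * x     ≡⟨ cong (_* x) (∣⇒·1≡0 d) ⟩
    0# * x           ≡⟨ zeroˡ x ⟩
    0#               ∎

  private
    q-binomial : ∀ i → 0 < i → i < q → p ∣ q C i
    q-binomial = prime∣binomial pr k q≡p^k

  frobenius : ∀ x y → (x + y) ^ˢ q ≡ x ^ˢ q + y ^ˢ q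
  frobenius x y = go q refl
    where
    go : ∀ r → r ≡ q → (x + y) ^ˢ r ≡ x ^ˢ r + y ^ˢ r
    go zero    0≡q = ⊥-elim (ℕ.<-irrefl (trans 0≡q q≡p^k) (ℕ.m^n>0 p {{prime⇒nonZero pr}} k))
    go (suc r) refl = begin
      (x + y) ^ˢ suc r                              ≡⟨ Binomial.theorem (suc r) x y ⟩
      t zero + ∑.sum (t ∘ suc)                     ≡⟨ cong (t zero +_) (sum-single +-commutativeMonoid (t ∘ suc) (fromℕ r) middle) ⟩
      t zero + t (fromℕ (suc r))                   ≡⟨ cong₂ _+_ first last ⟩
      y ^ˢ suc r + x ^ˢ suc r                        ≡⟨ +-comm _ _ ⟩
      x ^ˢ suc r + y ^ˢ suc r                        ∎
      where
      t = Binomial.binomialTerm x y (suc r)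
      middle : ∀ i → i ≢ fromℕ r → t (suc i) ≡ 0#
      middle i i≢ = ∣⇒·≡0 (q-binomial (suc (toℕ i)) (s≤s z≤n) (s≤s (ℕ.≤∧≢⇒< (ℕ.≤-pred (Fin.toℕ<n i))
        (λ e → i≢ (Fin.toℕ-injective (trans e (sym (Fin.toℕ-fromℕ r)))))))) _
      first : t zero ≡ y ^ˢ suc r
      first = trans (+-identityʳ _) (*-identityˡ _)
      last : t (fromℕ (suc r)) ≡ x ^ˢ suc r
      last rewrite Fin.toℕ-fromℕ r | nCn≡1 (suc r) | ℕ.n∸n≡0 r = trans (+-identityʳ _) (*-identityʳ _)

  frobenius-iter : ∀ i x y → (x + y) ^ˢ (q ℕ.^ i) ≡ x ^ˢ (q ℕ.^ i) + y ^ˢ (q ℕ.^ i)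
  frobenius-iter zero    x y = trans (*-identityʳ _) (sym (cong₂ _+_ (*-identityʳ x) (*-identityʳ y)))
  frobenius-iter (suc i) x y = begin
    (x + y) ^ˢ (q ℕ.* q ℕ.^ i)                            ≡⟨ ^-assocʳ (x + y) q (q ℕ.^ i) ⟨
    ((x + y) ^ˢ q) ^ˢ (q ℕ.^ i)                            ≡⟨ cong (_^ˢ (q ℕ.^ i)) (frobenius x y) ⟩
    (x ^ˢ q + y ^ˢ q) ^ˢ (q ℕ.^ i)                          ≡⟨ frobenius-iter i (x ^ˢ q) (y ^ˢ q) ⟩
    (x ^ˢ q) ^ˢ (q ℕ.^ i) + (y ^ˢ q) ^ˢ (q ℕ.^ i)            ≡⟨ cong₂ _+_ (^-assocʳ x q _) (^-assocʳ y q _) ⟩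
    x ^ˢ (q ℕ.* q ℕ.^ i) + y ^ˢ (q ℕ.* q ℕ.^ i)            ∎

  tr : Carrier → Carrier
  tr x = sumUpTo n (λ i → x ^ˢ (q ℕ.^ i))

  tr-+ : ∀ x y → tr (x + y) ≡ tr x + tr y
  tr-+ x y = trans (sumUpTo-cong n (λ i _ → frobenius-iter i x y)) (sumUpTo-+ n _ _)

  0^q≡0 : 0# ^ˢ q ≡ 0#
  0^q≡0 = +-cancelˡ (0# ^ˢ q) _ _ (trans (sym (frobenius 0# 0#)) (trans (cong (_^ˢ q) (+-identityʳ 0#)) (sym (+-identityʳ _))))

  sumUpTo-^q : ∀ m f → sumUpTo m f ^ˢ q ≡ sumUpTo m (λ i → f i ^ˢ q)
  sumUpTo-^q zero    f = 0^q≡0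
  sumUpTo-^q (suc m) f = trans (frobenius _ _) (cong (_+ f m ^ˢ q) (sumUpTo-^q m f))

  -- The Frobenius map shifts the conjugates cyclically: the new last one, `x^(q^n)`, is `x` by
  -- `fermat`.
  tr^q : ∀ x → tr x ^ˢ q ≡ tr x
  tr^q x = +-cancelʳ (f 0) _ _ (begin
    tr x ^ˢ q + f 0                      ≡⟨ cong (_+ f 0) (sumUpTo-^q n f) ⟩
    sumUpTo n (λ i → f i ^ˢ q) + f 0     ≡⟨ cong (_+ f 0) (sumUpTo-cong n (λ i _ →
                                             trans (^-assocʳ x (q ℕ.^ i) q) (cong (x ^ˢ_) (ℕ.*-comm (q ℕ.^ i) q)))) ⟩
    sumUpTo n (f ∘ suc) + f 0           ≡⟨ sumUpTo-shift n f ⟩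
    tr x + f n                          ≡⟨ cong (tr x +_) (trans (fermat x) (sym (*-identityʳ x))) ⟩
    tr x + f 0                          ∎)
    where
    f : ℕ → Carrier
    f i = x ^ˢ (q ℕ.^ i)

  -- Neighbours `r C i` and `r C suc i` add up to `q C suc i`, which vanishes in `K`; so if one were
  -- zero, the zero would propagate down to `r C 0`, which is 1.
  binomial-nonzero : ∀ {r} → q ≡ suc r → ∀ i → i < q → (r C i) · 1# ≢ 0#
  binomial-nonzero refl zero    _   eq = 1≢0 (trans (sym (+-identityʳ 1#)) eq)
  binomial-nonzero {r} refl (suc i) i<q eq = binomial-nonzero refl i (ℕ.<-trans (ℕ.n<1+n i) i<q) (begin
    (r C i) · 1#                        ≡⟨ +-identityʳ _ ⟨
    (r C i) · 1# + 0#                   ≡⟨ cong ((r C i) · 1# +_) eq ⟨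
    (r C i) · 1# + (r C suc i) · 1#     ≡⟨ ×-homo-+ 1# (r C i) (r C suc i) ⟨
    (r C i ℕ.+ r C suc i) · 1#          ≡⟨ cong (_· 1#) (nCk+nC[k+1]≡[n+1]C[k+1] r i) ⟩
    (q C suc i) · 1#                    ≡⟨ ∣⇒·1≡0 (q-binomial (suc i) (s≤s z≤n) i<q) ⟩
    0#                                  ∎)

  -- Multiplying `S = G + ... + G^(q-1)` by `G` trades the term `G` for `G^q`, which equals `G`.
  -- Hence `G * S ≡ S`.
  geometric : ∀ r → q ≡ suc r → ∀ {G} → G ^ˢ q ≡ G → G ≢ 1# → sumUpTo r (λ j → G ^ˢ suc j) ≡ 0#
  geometric r refl {G} G^q≡G G≢1 = *-cancelʳ-or G 1# S (+-cancelʳ G _ _ (begin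
    G * S + G                                       ≡⟨ cong₂ _+_ (sumUpTo-*ˡ r G _) (sym (*-identityʳ G)) ⟩
    sumUpTo r (λ j → G ^ˢ suc (suc j)) + G ^ˢ 1       ≡⟨ sumUpTo-shift r (λ j → G ^ˢ suc j) ⟩
    S + G ^ˢ suc r                                   ≡⟨ cong₂ _+_ (sym (*-identityˡ S)) G^q≡G ⟩
    1# * S + G                                      ∎)) G≢1
    where
    S = sumUpTo r (λ j → G ^ˢ suc j)

  -- The weighted sum over `K*` and the contradiction.

  module _ {t} (q≡ : q ≡ suc (suc t ℕ.+ suc t)) (5≤n : 5 ≤ n) {b} (b≢0 : b ≢ 0#)
           (G≢1 : ∀ x → x ≢ 0# → tr x * tr (b * inv x) ≢ 1#) where
    private
      h = suc t
      U V : ℕ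
      U = h ℕ.* q ℕ.^ 2 ℕ.+ h ℕ.* q ℕ.^ 3
      V = h ℕ.* q ℕ.^ 0 ℕ.+ h ℕ.* q ℕ.^ 1

      G W : Carrier → Carrier
      G x = tr x * tr (b * inv x)
      -- The extra factor `x * inv x` is `1#` on `K*` and `0#` at `0#`; it confines every weighted
      -- sum to `K*`.
      W x = x ^ˢ suc U * inv x ^ˢ suc V

      -- The contribution of a surviving pair of words: `w′` has value `U`, and a diagonal power sum
      -- is `-1`.
      c : Carrier
      c = b ^ˢ U * - 1#

      c≢0 : c ≢ 0#
      c≢0 = *-nonzero (^-nonzero U b≢0) -1≢0

      φ ψ : List ℕ → Carrier
      φ = ind 0 1 h h
      ψ = ind 2 3 h h

      V≤U : V ≤ U
      V≤U = lower≤upper q {{subst ℕ.NonZero (sym q≡) _}} h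

      -- The product `φ w * ψ w′` detects equality of the two exponents. Equality forces the letter
      -- counts by `digits-of-words`; conversely, these counts give `w` the value `V` and `w′` the
      -- value `U`, and both exponents become `U + V`.
      coefficient : ∀ w w′ → length w ≤ h ℕ.+ h → length w′ ≤ h ℕ.+ h → All (_< n) w → All (_< n) w′ →
                    b ^ˢ val q w′ * powerSum (val q w ℕ.+ U) (val q w′ ℕ.+ V) ≡ c * (φ w * ψ w′)
      coefficient w w′ l l′ a a′ with val q w ℕ.+ U ℕ.≟ val q w′ ℕ.+ V
      ... | yes E≡F = begin
        b ^ˢ val q w′ * powerSum (val q w ℕ.+ U) (val q w′ ℕ.+ V)
          ≡⟨ cong₂ _*_ (cong (b ^ˢ_) val-w′) (trans (cong (powerSum (val q w ℕ.+ U)) (sym E≡F)) (powerSum-diag (val q w ℕ.+ U))) ⟩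
        c                   ≡⟨ *-identityʳ c ⟨
        c * 1#              ≡⟨ cong (c *_) (trans (sym (*-identityˡ 1#)) (sym (cong₂ _*_ φ≡1 ψ≡1))) ⟩
        c * (φ w * ψ w′)    ∎
        where
        cnt = digits-of-words t q≡ w w′ l l′ E≡F
        φ≡1 : φ w ≡ 1#
        φ≡1 = ind-one (λ ()) h h w (proj₁ (proj₁ cnt)) (proj₂ (proj₁ cnt)) l
        ψ≡1 : ψ w′ ≡ 1#
        ψ≡1 = ind-one (λ ()) h h w′ (proj₁ (proj₂ cnt)) (proj₂ (proj₂ cnt)) l′
        val-w′ : val q w′ ≡ U
        val-w′ with ind-support {2} {3} (λ ()) q h h w′
        ... | inj₁ z = ⊥-elim (1≢0 (trans (sym ψ≡1) z))
        ... | inj₂ (_ , e) = e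
      ... | no E≢F = begin
        b ^ˢ val q w′ * powerSum (val q w ℕ.+ U) (val q w′ ℕ.+ V)
          ≡⟨ cong (b ^ˢ val q w′ *_) (powerSum-offdiag (exponent-bound t q≡ 5≤n l a ℕ.≤-refl) (exponent-bound t q≡ 5≤n l′ a′ V≤U) E≢F) ⟩
        b ^ˢ val q w′ * 0#   ≡⟨ zeroʳ _ ⟩
        0#                  ≡⟨ zeroʳ c ⟨
        c * 0#              ≡⟨ cong (c *_) φψ≡0 ⟨
        c * (φ w * ψ w′)    ∎
        where
        φψ≡0 : φ w * ψ w′ ≡ 0#
        φψ≡0 with ind-support {0} {1} (λ ()) q h h w | ind-support {2} {3} (λ ()) q h h w′
        ... | inj₁ z | _ = trans (cong (_* ψ w′) z) (zeroˡ _)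
        ... | inj₂ _ | inj₁ z = trans (cong (φ w *_) z) (zeroʳ _)
        ... | inj₂ (_ , e) | inj₂ (_ , e′) =
          ⊥-elim (E≢F (trans (cong (ℕ._+ U) e) (trans (ℕ.+-comm V U) (cong (ℕ._+ V) (sym e′)))))

      term : ∀ x w w′ → W x * (x ^ˢ val q w * (b * inv x) ^ˢ val q w′) ≡
             b ^ˢ val q w′ * (x ^ˢ suc (val q w ℕ.+ U) * inv x ^ˢ suc (val q w′ ℕ.+ V))
      term x w w′ = begin
        x * x ^ˢ U * (y * y ^ˢ V) * (x ^ˢ E * (b * y) ^ˢ F)
          ≡⟨ cong (λ z → x * x ^ˢ U * (y * y ^ˢ V) * (x ^ˢ E * z)) (^-distrib-* b y F) ⟩
        x * x ^ˢ U * (y * y ^ˢ V) * (x ^ˢ E * (b ^ˢ F * y ^ˢ F))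
          ≡⟨ solve 7 (λ x xu y yv xe bf yf → x :* xu :* (y :* yv) :* (xe :* (bf :* yf)) := bf :* (x :* (xe :* xu) :* (y :* (yf :* yv))))
               refl x (x ^ˢ U) y (y ^ˢ V) (x ^ˢ E) (b ^ˢ F) (y ^ˢ F) ⟩
        b ^ˢ F * (x * (x ^ˢ E * x ^ˢ U) * (y * (y ^ˢ F * y ^ˢ V)))
          ≡⟨ cong₂ (λ u v → b ^ˢ F * (x * u * (y * v))) (^-homo-* x E U) (^-homo-* y F V) ⟨
        b ^ˢ F * (x ^ˢ suc (E ℕ.+ U) * y ^ˢ suc (F ℕ.+ V)) ∎
        where
        y = inv x
        E = val q w
        F = val q w′

      -- The coefficient is a factor in `w` times a factor in `w′`, so after summation over `x` the
      -- double sum over words splits into a product again.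
      weighted : ∀ j → suc j ≤ h ℕ.+ h → ∑ᴷ (λ x → W x * G x ^ˢ suc j) ≡
                 c * (sumWords n (suc j) φ * sumWords n (suc j) ψ)
      weighted j j< = begin
        ∑ᴷ (λ x → W x * G x ^ˢ j⁺)
          ≡⟨ ∑ᴷ-cong expand ⟩
        ∑ᴷ (λ x → sumWords n j⁺ (λ w → sumWords n j⁺ (λ w′ → m w w′ * p′ x w w′)))
          ≡⟨ ∑ᴷ-sumWords n j⁺ (λ x w → sumWords n j⁺ (λ w′ → m w w′ * p′ x w w′)) ⟩
        sumWords n j⁺ (λ w → ∑ᴷ (λ x → sumWords n j⁺ (λ w′ → m w w′ * p′ x w w′)))
          ≡⟨ sumWords-cong n j⁺ (λ w l a → trans (∑ᴷ-sumWords n j⁺ (λ x w′ → m w w′ * p′ x w w′))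
               (sumWords-cong n j⁺ (λ w′ l′ a′ → trans (∑ᴷ-*ˡ (m w w′) (λ x → p′ x w w′))
                 (coefficient w w′ (≤j⁺ l) (≤j⁺ l′) a a′)))) ⟩
        sumWords n j⁺ (λ w → sumWords n j⁺ (λ w′ → c * (φ w * ψ w′)))
          ≡⟨ sumWords-cong n j⁺ (λ w _ _ → sumWords-*ˡ n j⁺ c (λ w′ → φ w * ψ w′)) ⟨
        sumWords n j⁺ (λ w → c * sumWords n j⁺ (λ w′ → φ w * ψ w′))
          ≡⟨ sumWords-*ˡ n j⁺ c (λ w → sumWords n j⁺ (λ w′ → φ w * ψ w′)) ⟨
        c * sumWords n j⁺ (λ w → sumWords n j⁺ (λ w′ → φ w * ψ w′))
          ≡⟨ cong (c *_) (sumWords-* n j⁺ φ ψ) ⟨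
        c * (sumWords n j⁺ φ * sumWords n j⁺ ψ) ∎
        where
        j⁺ = suc j
        ≤j⁺ : ∀ {i} → i ≡ j⁺ → i ≤ h ℕ.+ h
        ≤j⁺ refl = j<
        m : List ℕ → List ℕ → Carrier
        m w w′ = b ^ˢ val q w′
        p′ : Carrier → List ℕ → List ℕ → Carrier
        p′ x w w′ = x ^ˢ suc (val q w ℕ.+ U) * inv x ^ˢ suc (val q w′ ℕ.+ V)
        expand : ∀ x → W x * G x ^ˢ j⁺ ≡ sumWords n j⁺ (λ w → sumWords n j⁺ (λ w′ → m w w′ * p′ x w w′))
        expand x = begin
          W x * (tr x * tr (b * inv x)) ^ˢ j⁺
            ≡⟨ cong (W x *_) (^-distrib-* (tr x) (tr (b * inv x)) j⁺) ⟩
          W x * (tr x ^ˢ j⁺ * tr (b * inv x) ^ˢ j⁺)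
            ≡⟨ cong (W x *_) (trans (cong₂ _*_ (power-expansion q n j⁺ x) (power-expansion q n j⁺ (b * inv x)))
                 (sumWords-* n j⁺ X Y)) ⟩
          W x * sumWords n j⁺ (λ w → sumWords n j⁺ (λ w′ → X w * Y w′))
            ≡⟨ trans (sumWords-*ˡ n j⁺ (W x) (λ w → sumWords n j⁺ (λ w′ → X w * Y w′))) (sumWords-cong n j⁺ (λ w _ _ →
                 trans (sumWords-*ˡ n j⁺ (W x) (λ w′ → X w * Y w′)) (sumWords-cong n j⁺ (λ w′ _ _ → term x w w′)))) ⟩
          sumWords n j⁺ (λ w → sumWords n j⁺ (λ w′ → m w w′ * p′ x w w′)) ∎
          where
          X Y : List ℕ → Carrier
          X w = x ^ˢ val q w
          Y w = (b * inv x) ^ˢ val q w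

      vanishing : ∑ᴷ (λ x → W x * sumUpTo (h ℕ.+ h) (λ j → G x ^ˢ suc j)) ≡ 0#
      vanishing = trans (∑ᴷ-cong (λ x → go x (x ≟ 0#))) ∑ᴷ-zero
        where
        go : ∀ x → Dec (x ≡ 0#) → W x * sumUpTo (h ℕ.+ h) (λ j → G x ^ˢ suc j) ≡ 0#
        go x (yes refl) = trans (cong (_* sumUpTo (h ℕ.+ h) (λ j → G 0# ^ˢ suc j))
          (trans (cong (_* inv 0# ^ˢ suc V) (zeroˡ (0# ^ˢ U))) (zeroˡ _))) (zeroˡ _)
        go x (no x≢0) = trans (cong (W x *_) (geometric (h ℕ.+ h) q≡
          (trans (^-distrib-* (tr x) (tr (b * inv x)) q) (cong₂ _*_ (tr^q x) (tr^q (b * inv x)))) (G≢1 x x≢0))) (zeroʳ _)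

      -- Words shorter than `2h` cannot hold the required letters, so only the top power `G^(2h)`,
      -- at index `t + h`, contributes.
      last-term : sumUpTo (h ℕ.+ h) (λ j → ∑ᴷ (λ x → W x * G x ^ˢ suc j)) ≡ c * (((h ℕ.+ h) C h) · 1# * ((h ℕ.+ h) C h) · 1#)
      last-term = begin
        sumUpTo (t ℕ.+ h) f + f (t ℕ.+ h)   ≡⟨ cong₂ _+_ (sumUpTo-zero (t ℕ.+ h) early) (weighted (t ℕ.+ h) ℕ.≤-refl) ⟩
        0# + c * (sumWords n (h ℕ.+ h) φ * sumWords n (h ℕ.+ h) ψ)
          ≡⟨ +-identityˡ _ ⟩
        c * (sumWords n (h ℕ.+ h) φ * sumWords n (h ℕ.+ h) ψ)
          ≡⟨ cong (c *_) (cong₂ _*_ (sumWords-ind (λ ()) (<n 0 (s≤s z≤n)) (<n 1 (s≤s (s≤s z≤n))) (h ℕ.+ h) h h refl)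
                                    (sumWords-ind (λ ()) (<n 2 (s≤s (s≤s (s≤s z≤n)))) (<n 3 (s≤s (s≤s (s≤s (s≤s z≤n))))) (h ℕ.+ h) h h refl)) ⟩
        c * (((h ℕ.+ h) C h) · 1# * ((h ℕ.+ h) C h) · 1#) ∎
        where
        f : ℕ → Carrier
        f j = ∑ᴷ (λ x → W x * G x ^ˢ suc j)
        <n : ∀ i → suc i ≤ 5 → i < n
        <n i i<5 = ℕ.≤-trans i<5 5≤n
        early : ∀ j → j < t ℕ.+ h → f j ≡ 0#
        early j j<t+h = begin
          f j                                                          ≡⟨ weighted j (s≤s (ℕ.<⇒≤ j<t+h)) ⟩
          c * (sumWords n (suc j) φ * sumWords n (suc j) ψ)            ≡⟨ cong (λ z → c * (z * sumWords n (suc j) ψ))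
             (sumWords-ind-zero {0} {1} (λ ()) (<n 0 (s≤s z≤n)) (<n 1 (s≤s (s≤s z≤n))) (suc j) h h (ℕ.<⇒≢ (s≤s j<t+h))) ⟩
          c * (0# * sumWords n (suc j) ψ)                              ≡⟨ trans (cong (c *_) (zeroˡ _)) (zeroʳ c) ⟩
          0#                                                           ∎

    trace-contradiction : ⊥
    trace-contradiction = *-nonzero c≢0 (*-nonzero B≢0 B≢0) (begin
      c * (((h ℕ.+ h) C h) · 1# * ((h ℕ.+ h) C h) · 1#)                 ≡⟨ last-term ⟨
      sumUpTo (h ℕ.+ h) (λ j → ∑ᴷ (λ x → W x * G x ^ˢ suc j))            ≡⟨ ∑ᴷ-sumUpTo (h ℕ.+ h) (λ x j → W x * G x ^ˢ suc j) ⟨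
      ∑ᴷ (λ x → sumUpTo (h ℕ.+ h) (λ j → W x * G x ^ˢ suc j))            ≡⟨ ∑ᴷ-cong (λ x → sumUpTo-*ˡ (h ℕ.+ h) (W x) (λ j → G x ^ˢ suc j)) ⟨
      ∑ᴷ (λ x → W x * sumUpTo (h ℕ.+ h) (λ j → G x ^ˢ suc j))            ≡⟨ vanishing ⟩
      0#                                                                ∎)
      where
      B≢0 : ((h ℕ.+ h) C h) · 1# ≢ 0#
      B≢0 = binomial-nonzero q≡ h (subst (h <_) (sym q≡) (s≤s (ℕ.m≤m+n h h)))

-- From planarity to the condition on traces.

module Planarity (q n p k : ℕ) (pr : Prime p) (1≤k : 1 ≤ k) (q≡p^k : q ≡ p ^ k) (5≤n : 5 ≤ n)
                 (K : FiniteField (q ^ n)) where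
  open FiniteField K
  open FieldTheory K
  open Trace q n p k pr q≡p^k K
  open WordSums K using (sumUpTo-cong)
  open CommutativeRing ring using
    (+-assoc; +-identityʳ; *-identityʳ; zeroˡ; zeroʳ; distribˡ; -‿inverseʳ; commutativeSemiring)
  open import Algebra.Properties.Ring (CommutativeRing.ring ring) using (+-cancelˡ)
  open import Algebra.Properties.CommutativeSemiring.Exp commutativeSemiring
    using (^-distrib-*) renaming (_^_ to _^ˢ_)
  open import Algebra.Solver.Ring.NaturalCoefficients.Default commutativeSemiring
    using (solve; _:+_; _:*_; _:=_; con)
  open ≡-Reasoning

  ^ᶠ≡^ : ∀ x m → x ^ᶠ m ≡ x ^ˢ m
  ^ᶠ≡^ x zero    = refl
  ^ᶠ≡^ x (suc m) = cong (x *_) (^ᶠ≡^ x m)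

  Tr≡tr : ∀ x → Tr q n K x ≡ tr x
  Tr≡tr x = sumUpTo-cong n (λ i _ → ^ᶠ≡^ x (q ^ i))

  module _ (a : Carrier) where
    F : Carrier → Carrier
    F x = (Tr q n K x ^ᶠ 2) + a * (x ^ᶠ 2)

    F-tr : ∀ x → F x ≡ tr x ^ˢ 2 + a * x ^ˢ 2
    F-tr x = cong₂ (λ u v → u + a * v) (trans (^ᶠ≡^ (Tr q n K x) 2) (cong (_^ˢ 2) (Tr≡tr x))) (^ᶠ≡^ x 2)

    -- The symmetric bilinear form whose diagonal is the quadratic form `F`.
    B : Carrier → Carrier → Carrier
    B x y = tr x * tr y + a * (x * y)

    polarization : ∀ x y → F (x + y) - F x - F y ≡ B x y + B x y
    polarization x y = begin
      F (x + y) - F x - F y                        ≡⟨ cong (λ z → z - F x - F y) expand ⟩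
      B x y + B x y + F y + F x - F x - F y        ≡⟨ cong (_- F y) (cancel (B x y + B x y + F y) (F x)) ⟩
      B x y + B x y + F y - F y                    ≡⟨ cancel (B x y + B x y) (F y) ⟩
      B x y + B x y                                ∎
      where
      cancel : ∀ u v → u + v - v ≡ u
      cancel u v = trans (+-assoc u v (- v)) (trans (cong (u +_) (-‿inverseʳ v)) (+-identityʳ u))
      expand : F (x + y) ≡ B x y + B x y + F y + F x
      expand = begin
        F (x + y)                                           ≡⟨ F-tr (x + y) ⟩
        tr (x + y) ^ˢ 2 + a * (x + y) ^ˢ 2                  ≡⟨ cong (λ t → t ^ˢ 2 + a * (x + y) ^ˢ 2) (tr-+ x y) ⟩
        (tr x + tr y) ^ˢ 2 + a * (x + y) ^ˢ 2
          ≡⟨ solve 5 (λ s t a x y → (s :+ t) :* ((s :+ t) :* con 1) :+ a :* ((x :+ y) :* ((x :+ y) :* con 1))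
               := (s :* t :+ a :* (x :* y)) :+ (s :* t :+ a :* (x :* y)) :+ (t :* (t :* con 1) :+ a :* (y :* (y :* con 1)))
                  :+ (s :* (s :* con 1) :+ a :* (x :* (x :* con 1)))) refl (tr x) (tr y) a x y ⟩
        B x y + B x y + (tr y ^ˢ 2 + a * y ^ˢ 2) + (tr x ^ˢ 2 + a * x ^ˢ 2)
          ≡⟨ cong₂ (λ u v → B x y + B x y + u + v) (F-tr y) (F-tr x) ⟨
        B x y + B x y + F y + F x                           ∎

    module _ (planar : Planar K F) where
      -- The difference map of `y` vanishes at `0#`, so injectivity leaves it no other zero. Keeping
      -- `B x y + B x y` undivided covers characteristic 2, where it vanishes identically and
      -- planarity fails at once.
      B-nondegenerate : ∀ x y → y ≢ 0# → B x y + B x y ≡ 0# → x ≡ 0#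
      B-nondegenerate x y y≢0 eq = proj₁ (planar y y≢0) (begin
        F (x + y) - F x - F y          ≡⟨ polarization x y ⟩
        B x y + B x y                  ≡⟨ trans eq (sym (+-identityʳ 0#)) ⟩
        0# + 0#                        ≡⟨ cong₂ _+_ B0y B0y ⟨
        B 0# y + B 0# y                ≡⟨ polarization 0# y ⟨
        F (0# + y) - F 0# - F y        ∎)
        where
        tr0 : tr 0# ≡ 0#
        tr0 = +-cancelˡ (tr 0#) _ _ (trans (sym (tr-+ 0# 0#)) (trans (cong tr (+-identityʳ 0#)) (sym (+-identityʳ _))))
        B0y : B 0# y ≡ 0#
        B0y = trans (cong₂ (λ s z → s * tr y + a * z) tr0 (zeroˡ y)) (trans (cong₂ _+_ (zeroˡ _) (zeroʳ a)) (+-identityʳ 0#))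

      p≢2 : p ≢ 2
      p≢2 refl = 1≢0 (B-nondegenerate 1# 1# 1≢0 (trans (cong (B 1# 1# +_) (sym (+-identityʳ _))) (∣⇒·≡0 (divides 1 refl) (B 1# 1#))))

      1<q : 1 < q
      1<q = subst (1 <_) (sym q≡p^k) (ℕ.<-≤-trans (ℕ.nonTrivial⇒n>1 p {{prime⇒nonTrivial pr}})
              (subst (_≤ p ^ k) (ℕ.^-identityʳ p) (ℕ.^-monoʳ-≤ p {{prime⇒nonZero pr}} 1≤k)))

      q<N : q < q ^ n
      q<N = subst (_< q ^ n) (ℕ.^-identityʳ q) (ℕ.^-monoʳ-< q 1<q (ℕ.≤-trans (s≤s (s≤s z≤n)) 5≤n))

      -- For a = 0 the difference map takes values in the fixed field of the Frobenius x ↦ x^q, which is not all of K.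
      a≢0 : a ≢ 0#
      a≢0 refl = fixed q refl
        where
        B-fixed : ∀ x → (B x 1# + B x 1#) ^ˢ q ≡ B x 1# + B x 1#
        B-fixed x = trans (frobenius (B x 1#) (B x 1#)) (cong₂ _+_ half half)
          where
          B≡ : B x 1# ≡ tr x * tr 1#
          B≡ = trans (cong (tr x * tr 1# +_) (zeroˡ _)) (+-identityʳ _)
          half : B x 1# ^ˢ q ≡ B x 1#
          half = trans (cong (_^ˢ q) B≡) (trans (^-distrib-* (tr x) (tr 1#) q) (trans (cong₂ _*_ (tr^q x) (tr^q 1#)) (sym B≡)))
        all-fixed : ∀ z → z ^ˢ q ≡ z
        all-fixed z = let (x , hit) = proj₂ (planar 1# 1≢0) z
                          eq = trans (sym (polarization x 1#)) (hit refl)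
                      in trans (cong (_^ˢ q) (sym eq)) (trans (B-fixed x) eq)
        fixed : ∀ r → r ≡ q → ⊥
        fixed zero          refl = ⊥-elim (ℕ.<⇒≱ 1<q z≤n)
        fixed (suc zero)    refl = ℕ.<-irrefl refl 1<q
        fixed (suc (suc d)) refl = ^≢id d q<N all-fixed

      not-planar : ⊥
      not-planar with prime≡2∨odd-power pr k
      ... | inj₁ p≡2 = p≢2 p≡2
      ... | inj₂ (zero , eq) = ℕ.<-irrefl (sym (trans q≡p^k eq)) 1<q
      ... | inj₂ (suc t , eq) = trace-contradiction (trans q≡p^k eq) 5≤n b≢0 G≢1
        where
        b = - inv a
        ab : a * b ≡ - 1#
        ab = +-cancelˡ 1# _ _ (begin
          1# + a * b           ≡⟨ cong (_+ a * b) (*-inv a≢0) ⟨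
          a * inv a + a * b    ≡⟨ distribˡ a (inv a) b ⟨
          a * (inv a + b)      ≡⟨ cong (a *_) (-‿inverseʳ (inv a)) ⟩
          a * 0#               ≡⟨ zeroʳ a ⟩
          0#                   ≡⟨ -‿inverseʳ 1# ⟨
          1# + - 1#            ∎)
        b≢0 : b ≢ 0#
        b≢0 e = -1≢0 (trans (sym ab) (trans (cong (a *_) e) (zeroʳ a)))
        inv≢0 : ∀ {x} → x ≢ 0# → inv x ≢ 0#
        inv≢0 {x} x≢0 e = 1≢0 (trans (sym (*-inv x≢0)) (trans (cong (x *_) e) (zeroʳ x)))
        -- The choice `y = b * inv x` makes `a * (x * y)` constantly `-1`, so that `B x y` becomes
        -- `tr x * tr y - 1`.
        G≢1 : ∀ x → x ≢ 0# → tr x * tr (b * inv x) ≢ 1#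
        G≢1 x x≢0 G≡1 = x≢0 (B-nondegenerate x (b * inv x) (*-nonzero b≢0 (inv≢0 x≢0))
          (trans (cong₂ _+_ B≡0 B≡0) (+-identityʳ 0#)))
          where
          B≡0 : B x (b * inv x) ≡ 0#
          B≡0 = begin
            tr x * tr (b * inv x) + a * (x * (b * inv x))
              ≡⟨ cong₂ _+_ G≡1 (solve 4 (λ a x b y → a :* (x :* (b :* y)) := (a :* b) :* (x :* y)) refl a x b (inv x)) ⟩
            1# + a * b * (x * inv x)     ≡⟨ cong (1# +_) (trans (cong₂ _*_ ab (*-inv x≢0)) (*-identityʳ _)) ⟩
            1# + - 1#                    ≡⟨ -‿inverseʳ 1# ⟩
            0#                           ∎

theorem6p15 : (q n : ℕ) → PrimePower q → 5 ≤ n →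
    (K : FiniteField (q ^ n)) → (a : FiniteField.Carrier K) →
    ¬ Planar K (λ x → let open FiniteField K in
    (Tr q n K x ^ᶠ 2) + a * (x ^ᶠ 2))
theorem6p15 q n (p , k , pr , 1≤k , q≡p^k) 5≤n K a = Planarity.not-planar q n p k pr 1≤k q≡p^k 5≤n K a
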